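{- Let $k\ge 1$ and $q\ge 1$ be integers, and suppose that the complete multipartite graph $K_{k\times q}$ (with $q$ parts, each of size $k$) can be partitioned into edge-disjoint copies of the complete graph $K_{k+1}$ (i.e. a $(k+1)$-GDD of type $k^q$ exists). Then, with $N=2kq+1$ and $C=\frac{k(k+1)}{2}$, there is a valid partition of the request tournament $T_N$ of cost $\frac{N(N-1)}{2k}$, and this is optimal: $A\!\left(\frac{k(k+1)}{2},\,2kq+1\right)=\frac{N(N-1)}{2k}$.
   Context: Fix integers $N\ge 2$ and $C\ge 1$ (the grooming factor). Let $\vec C_N$ be the directed cycle on vertices $0,1,\dots,N-1$ with arcs $(i,i+1 \bmod N)$. For distinct vertices $u,v$ let $d(u,v)=(v-u)\bmod N$ be the length of the directed path from $u$ to $v$ in $\vec C_N$. A request tournament $T_N$ is a tournament on $\{0,\dots,N-1\}$ containing every arc $(u,v)$ with $d(u,v)<N/2$ and, when $N$ is even, exactly one of the two arcs $(i,i+N/2)$, $(i+N/2,i)$ for each $0\le i<N/2$ (for $N$ odd, $T_N$ is unique). Each arc $(u,v)$ of $T_N$ is routed along the directed path from $u$ to $v$ in $\vec C_N$. For a subdigraph $B$ of $T_N$ and an arc $e$ of $\vec C_N$, the load $L(B,e)$ is the number of arcs of $B$ whose route contains $e$; $B$ is admissible if $L(B,e)\le C$ for every arc $e$. A valid partition is a partition of the arc set of $T_N$ into admissible subdigraphs $B_1,\dots,B_W$, where $V(B_\omega)$ is the set of endpoints of arcs of $B_\omega$; its cost is $\sum_\omega |V(B_\omega)|$. $A(C,N)$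 denotes the minimum cost of a valid partition over all choices of $T_N$ and all valid partitions. -}

module Defs where

open import Data.Nat using (ℕ; zero; suc; _+_; _*_; _∸_; _≤_; _<_; NonZero)
open import Data.Nat.DivMod using (_%_; _/_)
open import Data.Nat.Properties using (_<?_; _≤?_)
open import Data.Fin using (Fin; toℕ) renaming (zero to fzero; suc to fsuc)
import Data.Fin as F
open import Data.Bool using (Bool; true; false; not; if_then_else_; _∧_; _∨_)
open import Data.Product using (Σ; ∃; _×_; _,_; proj₁)
open import Relation.Nullary using (¬_)
open import Relation.Nullary.Decidable using (⌊_⌋)
open import Relation.Binary.PropositionalEquality using (_≡_; _≢_)

countF : ∀ {n} → (Fin n → Bool) → ℕ
countF {zero}  p = 0
countF {suc n} p = (if p fzero then 1 else 0) + countF (λ i → p (fsuc i))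

sumF : ∀ {n} → (Fin n → ℕ) → ℕ
sumF {zero}  f = 0
sumF {suc n} f = f fzero + sumF (λ i → f (fsuc i))

anyF : ∀ {n} → (Fin n → Bool) → Bool
anyF {zero}  p = false
anyF {suc n} p = p fzero ∨ anyF (λ i → p (fsuc i))

-- The directed cycle on Fin N: arc e_i = (i, i+1 mod N) is identified
-- with its tail i.  d(u,v) = (v - u) mod N.

dist : (N : ℕ) .{{_ : NonZero N}} → Fin N → Fin N → ℕ
dist N u v = ((toℕ v + N) ∸ toℕ u) % N

Digraph : ℕ → Set
Digraph N = Fin N → Fin N → Bool

IsRequestTournament : (N : ℕ) .{{_ : NonZero N}} → Digraph N → Set
IsRequestTournament N T =
  (∀ u → T u u ≡ false) ×
  (∀ u v → u ≢ v → T v u ≡ not (T u v)) ×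
  (∀ u v → u ≢ v → 2 * dist N u v < N → T u v ≡ true)

-- The route of arc (u,v) (the directed path u → v in the cycle)
-- contains the cycle arc e_i = (i,i+1) iff d(u,i) < d(u,v).
routeUses : (N : ℕ) .{{_ : NonZero N}} → Fin N → Fin N → Fin N → Bool
routeUses N u v i = ⌊ dist N u i <? dist N u v ⌋

load : (N : ℕ) .{{_ : NonZero N}} → Digraph N → Fin N → ℕ
load N B i = sumF (λ u → countF (λ v → B u v ∧ routeUses N u v i))

Admissible : (C N : ℕ) .{{_ : NonZero N}} → Digraph N → Set
Admissible C N B = ∀ i → load N B i ≤ C

-- A partition of the arcs of T into W classes, given by a colouring
-- f of the arcs (the value of f on non-arcs of T is irrelevant).
-- Class ω is the subdigraph B_ω.
classOf : ∀ {N W} → Digraph N → (Fin N → Fin N → Fin W) → Fin W → Digraph N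
classOf T f ω u v = T u v ∧ ⌊ f u v F.≟ ω ⌋

vertexCount : ∀ {N} → Digraph N → ℕ
vertexCount B = countF (λ x → anyF (λ y → B x y ∨ B y x))

ValidPartition : (C N : ℕ) .{{_ : NonZero N}} → Digraph N →
                 (W : ℕ) → (Fin N → Fin N → Fin W) → Set
ValidPartition C N T W f = ∀ ω → Admissible C N (classOf T f ω)

cost : ∀ {N W} → Digraph N → (Fin N → Fin N → Fin W) → ℕ
cost T f = sumF (λ ω → vertexCount (classOf T f ω))

IsA : (C N : ℕ) .{{_ : NonZero N}} → ℕ → Set
IsA C N m =
  (Σ (Digraph N) λ T → IsRequestTournament N T ×
     Σ ℕ λ W → Σ (Fin N → Fin N → Fin W) λ f →
       ValidPartition C N T W f × cost T f ≡ m) ×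
  (∀ (T : Digraph N) → IsRequestTournament N T →
     ∀ (W : ℕ) (f : Fin N → Fin N → Fin W) →
       ValidPartition C N T W f → m ≤ cost T f)

-- (k+1)-GDD of type k^q: a partition of the edges of the complete
-- multipartite graph K_{k×q} (vertices Fin q × Fin k, group = first
-- coordinate) into edge-disjoint copies of K_{k+1}.

GVertex : ℕ → ℕ → Set
GVertex k q = Fin q × Fin k

_∈B_ : ∀ {k q} → GVertex k q → (Fin (suc k) → GVertex k q) → Set
x ∈B b = ∃ λ i → b i ≡ x

GDDType : (k q : ℕ) → Set
GDDType k q =
  Σ ℕ λ nb → Σ (Fin nb → Fin (suc k) → GVertex k q) λ B →
    -- every block is a copy of K_{k+1} in K_{k×q}: its k+1 vertices lie
    -- in pairwise distinct groups (hence are distinct and pairwise adjacent)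
    (∀ t (i j : Fin (suc k)) → i ≢ j → proj₁ (B t i) ≢ proj₁ (B t j)) ×
    (∀ (x y : GVertex k q) → proj₁ x ≢ proj₁ y →
       Σ (Fin nb) λ t → (x ∈B B t × y ∈B B t) ×
         (∀ t′ → x ∈B B t′ → y ∈B B t′ → t′ ≡ t))

{-# OPTIONS --safe #-}

-- Lower bound: with capacity k (k + 1) / 2, counting by load shows that an admissible class has at most
-- k arcs per vertex, so the N (N − 1) / 2 arcs of the tournament need at least N (N − 1) / 2k vertices.
--
-- Construction: take ∞ and two antipodal copies of every vertex of K_{k×q}.  A block of the GDD becomes
-- a class on its 2 (k + 1) copies, without the arcs between the two copies of a vertex, and a group becomes
-- a class on its 2k copies and ∞.  Both kinds load every arc of the ring with exactly k (k + 1) / 2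
-- and have exactly k arcs per vertex.

module Submission where

open import Defs
open import Data.Nat using (ℕ; zero; suc; _+_; _*_; _∸_; _≤_; _<_; NonZero; z≤n; s≤s; ≢-nonZero⁻¹)
open import Data.Nat.Properties
open import Data.Nat.DivMod using (_%_; _/_; m<n⇒m%n≡m; [m+n]%n≡m%n; m/n*n≤m; m*n/n≡m)
open import Data.Nat.Tactic.RingSolver using (solve-∀)
open import Data.Fin using (Fin; toℕ; _↑ˡ_; _↑ʳ_; splitAt; combine; remQuot; fromℕ<)
  renaming (zero to fzero; suc to fsuc)
import Data.Fin as F
open import Data.Fin.Properties using (toℕ<n; toℕ-injective; toℕ-↑ˡ; toℕ-↑ʳ; splitAt-↑ˡ; splitAt-↑ʳ; splitAt⁻¹-↑ˡ; splitAt⁻¹-↑ʳ;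
  remQuot-combine; combine-remQuot; ↑ˡ-injective; ↑ʳ-injective; any?)
open import Data.Bool using (Bool; true; false; not; if_then_else_; _∧_; _∨_)
open import Data.Bool.Properties using (∨-zeroʳ)
open import Data.Maybe using (Maybe; just; nothing; maybe′)
open import Data.Product using (Σ; ∃; _×_; _,_; proj₁; proj₂; uncurry)
open import Data.Sum using (_⊎_; inj₁; inj₂; [_,_]′)
open import Data.Empty using (⊥-elim)
open import Function using (_∘_; id)
open import Relation.Nullary using (¬_; Dec; yes; no)
open import Relation.Nullary.Decidable using (⌊_⌋)
open import Relation.Binary.Definitions using (tri<; tri≈; tri>)
open import Relation.Binary.PropositionalEquality

-- The out-degrees m in a class may differ, and the number of crossed gaps grows like m (m + 1) / 2.
-- Averaging therefore uses the secant of this convex function through m = k and m = k + 1, and a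
-- capacity of k (k + 1) / 2 is what makes the resulting ratio exactly k. Equality forces every gap
-- between consecutive vertices of a class to be full. Hence the classes are assembled from closed
-- walks that wind once: their load is the same on every arc of the ring, and admissibility becomes
-- a count of pairs of points. A point may lie in several blocks but lies in one group only. So
-- whatever belongs to a single point, namely the arc joining its two copies and its arcs at ∞, has
-- to go to the class of its group. The cost of the construction is only estimated from above; the
-- lower bound, applied to the construction itself, gives equality. No formula for the number of
-- blocks is assumed: it enters through the count of all ordered pairs of points.

𝟙 : Bool → ℕ
𝟙 b = if b then 1 else 0

module _ {a} {P : Set a} where

  ⌊⌋-true : (d : Dec P) → P → ⌊ d ⌋ ≡ true
  ⌊⌋-true (yes _) _ = refl
  ⌊⌋-true (no ¬p) p = ⊥-elim (¬p p)

  ⌊⌋-false : (d : Dec P) → ¬ P → ⌊ d ⌋ ≡ false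
  ⌊⌋-false (yes p) ¬p = ⊥-elim (¬p p)
  ⌊⌋-false (no _)  _  = refl

  ⌊⌋-sound : (d : Dec P) → ⌊ d ⌋ ≡ true → P
  ⌊⌋-sound (yes p) _ = p

𝟙-yes : ∀ {a} {P : Set a} (d : Dec P) → P → 𝟙 ⌊ d ⌋ ≡ 1
𝟙-yes d p = cong 𝟙 (⌊⌋-true d p)

𝟙-no : ∀ {a} {P : Set a} (d : Dec P) → ¬ P → 𝟙 ⌊ d ⌋ ≡ 0
𝟙-no d ¬p = cong 𝟙 (⌊⌋-false d ¬p)

𝟙-⇔ : ∀ {a b} {P : Set a} {Q : Set b} {d : Dec P} {e : Dec Q} → (P → Q) → (Q → P) → 𝟙 ⌊ d ⌋ ≡ 𝟙 ⌊ e ⌋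
𝟙-⇔ {d = yes p} {e} f g = sym (𝟙-yes e (f p))
𝟙-⇔ {d = no ¬p} {e} f g = sym (𝟙-no e (¬p ∘ g))

𝟙-∧ : ∀ a b → 𝟙 (a ∧ b) ≡ 𝟙 a * 𝟙 b
𝟙-∧ true  b = sym (+-identityʳ _)
𝟙-∧ false b = refl

𝟙-mono : ∀ {a b} → (a ≡ true → b ≡ true) → 𝟙 a ≤ 𝟙 b
𝟙-mono {false} h = z≤n
𝟙-mono {true}  h = ≤-reflexive (cong 𝟙 (sym (h refl)))

δ : ∀ {n} → Fin n → Fin n → ℕ
δ i j = 𝟙 ⌊ i F.≟ j ⌋

δ-refl : ∀ {n} (i : Fin n) → δ i i ≡ 1
δ-refl i = 𝟙-yes (i F.≟ i) refl

δ-≢ : ∀ {n} {i j : Fin n} → i ≢ j → δ i j ≡ 0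
δ-≢ {i = i} {j} i≢j = 𝟙-no (i F.≟ j) i≢j

δ-suc : ∀ {n} (i j : Fin n) → δ (fsuc i) (fsuc j) ≡ δ i j
δ-suc i j with i F.≟ j
... | yes refl = refl
... | no _     = refl

-- Finite sums

sum-cong : ∀ {n} {f g : Fin n → ℕ} → (∀ i → f i ≡ g i) → sumF f ≡ sumF g
sum-cong {zero}  h = refl
sum-cong {suc n} h = cong₂ _+_ (h fzero) (sum-cong (h ∘ fsuc))

sum-mono : ∀ {n} {f g : Fin n → ℕ} → (∀ i → f i ≤ g i) → sumF f ≤ sumF g
sum-mono {zero}  h = z≤n
sum-mono {suc n} h = +-mono-≤ (h fzero) (sum-mono (h ∘ fsuc))

sum-const : ∀ n a → sumF {n} (λ _ → a) ≡ n * a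
sum-const zero    a = refl
sum-const (suc n) a = cong (a +_) (sum-const n a)

sum-zero : ∀ {n} {f : Fin n → ℕ} → (∀ i → f i ≡ 0) → sumF f ≡ 0
sum-zero {n} h = trans (sum-cong h) (trans (sum-const n 0) (*-zeroʳ n))

+-interchange : ∀ a b c d → (a + b) + (c + d) ≡ (a + c) + (b + d)
+-interchange = solve-∀

sum-+ : ∀ {n} (f g : Fin n → ℕ) → sumF (λ i → f i + g i) ≡ sumF f + sumF g
sum-+ {zero}  f g = refl
sum-+ {suc n} f g = trans (cong (f fzero + g fzero +_) (sum-+ (f ∘ fsuc) (g ∘ fsuc)))
                          (+-interchange (f fzero) (g fzero) _ _)

sum-* : ∀ {n} a (f : Fin n → ℕ) → sumF (λ i → a * f i) ≡ a * sumF f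
sum-* {zero}  a f = sym (*-zeroʳ a)
sum-* {suc n} a f = trans (cong (a * f fzero +_) (sum-* a (f ∘ fsuc))) (sym (*-distribˡ-+ a _ _))

sum-swap : ∀ {m n} (f : Fin m → Fin n → ℕ) →
           sumF (λ i → sumF (f i)) ≡ sumF (λ j → sumF (λ i → f i j))
sum-swap {zero}  {n} f = sym (sum-zero {n} (λ _ → refl))
sum-swap {suc m} {n} f = trans (cong (sumF (f fzero) +_) (sum-swap (f ∘ fsuc)))
                           (sym (sum-+ {n} (f fzero) _))

sum-δ : ∀ {n} (i : Fin n) (f : Fin n → ℕ) → sumF (λ j → δ i j * f j) ≡ f i
sum-δ {suc n} fzero    f = trans (cong₂ _+_ (+-identityʳ (f fzero)) (sum-zero {n} (λ _ → refl))) (+-identityʳ _)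
sum-δ (fsuc i) f = trans (sum-cong (λ j → cong (_* f (fsuc j)) (δ-suc i j))) (sum-δ i (f ∘ fsuc))

sum-δ₁ : ∀ {n} (i : Fin n) → sumF (δ i) ≡ 1
sum-δ₁ i = trans (sum-cong (λ j → sym (*-identityʳ (δ i j)))) (sum-δ i (λ _ → 1))

sum-↑ : ∀ m {n} (f : Fin (m + n) → ℕ) →
        sumF f ≡ sumF (λ i → f (i ↑ˡ n)) + sumF (λ j → f (m ↑ʳ j))
sum-↑ zero    f = refl
sum-↑ (suc m) f = trans (cong (f fzero +_) (sum-↑ m (f ∘ fsuc))) (sym (+-assoc (f fzero) _ _))

sum-combine : ∀ m {n} (f : Fin (m * n) → ℕ) →
              sumF f ≡ sumF (λ i → sumF (λ j → f (combine {m} i j)))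
sum-combine zero        f = refl
sum-combine (suc m) {n} f = trans (sum-↑ n f) (cong (sumF (λ j → f (j ↑ˡ m * n)) +_) (sum-combine m (λ i → f (n ↑ʳ i))))

sum-×-sum : ∀ {m n} (f : Fin m → ℕ) (g : Fin n → ℕ) →
            sumF (λ i → sumF (λ j → f i * g j)) ≡ sumF f * sumF g
sum-×-sum f g = begin
  sumF (λ i → sumF (λ j → f i * g j)) ≡⟨ sum-cong (λ i → trans (sum-* (f i) g) (*-comm (f i) _)) ⟩
  sumF (λ i → sumF g * f i)           ≡⟨ sum-* (sumF g) f ⟩
  sumF g * sumF f                     ≡⟨ *-comm (sumF g) _ ⟩
  sumF f * sumF g                     ∎
  where open ≡-Reasoning

countF≡sum : ∀ {n} (p : Fin n → Bool) → countF p ≡ sumF (𝟙 ∘ p)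
countF≡sum {zero}  p = refl
countF≡sum {suc n} p = cong (𝟙 (p fzero) +_) (countF≡sum (p ∘ fsuc))

anyF-intro : ∀ {n} (p : Fin n → Bool) i → p i ≡ true → anyF p ≡ true
anyF-intro p fzero    h rewrite h = refl
anyF-intro p (fsuc i) h = trans (cong (p fzero ∨_) (anyF-intro (p ∘ fsuc) i h)) (∨-zeroʳ _)

anyF-elim : ∀ {n} (p : Fin n → Bool) → anyF p ≡ true → ∃ λ i → p i ≡ true
anyF-elim {suc n} p h with p fzero in eq
... | true  = fzero , eq
... | false with anyF-elim (p ∘ fsuc) h
...   | i , pi = fsuc i , pi

∨-elim : ∀ {a b} → a ∨ b ≡ true → a ≡ true ⊎ b ≡ true
∨-elim {true}  _ = inj₁ refl
∨-elim {false} h = inj₂ h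

∧-elim : ∀ {a b} → a ∧ b ≡ true → a ≡ true × b ≡ true
∧-elim {true} h = refl , h

-- By injectivity a fibre is empty or a single index, so the indicator of the image is a sum of
-- `δ`s; exchanging the sums then counts every index once.
sum-image : ∀ {m n} (h : Fin m → Fin n) → (∀ {i j} → h i ≡ h j → i ≡ j) →
            sumF (λ x → 𝟙 ⌊ any? (λ i → h i F.≟ x) ⌋) ≡ m
sum-image {m} {n} h inj = begin
  sumF (λ x → 𝟙 ⌊ any? (λ i → h i F.≟ x) ⌋) ≡⟨ sum-cong fibre ⟩
  sumF (λ x → sumF (λ i → δ (h i) x))         ≡⟨ sum-swap {n} {m} _ ⟩
  sumF (λ i → sumF (δ (h i)))                 ≡⟨ sum-cong (sum-δ₁ ∘ h) ⟩
  sumF {m} (λ _ → 1)                          ≡⟨ trans (sum-const m 1) (*-identityʳ m) ⟩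
  m                                           ∎
  where
  open ≡-Reasoning
  fibre : ∀ x → 𝟙 ⌊ any? (λ i → h i F.≟ x) ⌋ ≡ sumF (λ i → δ (h i) x)
  fibre x with any? (λ i → h i F.≟ x)
  ... | no none = sym (sum-zero (λ i → δ-≢ (λ e → none (i , e))))
  ... | yes (i , refl) = sym (trans (sum-cong δ-inj) (sum-δ₁ i))
    where
    δ-inj : ∀ j → δ (h j) (h i) ≡ δ i j
    δ-inj j with i F.≟ j
    ... | yes refl = δ-refl (h i)
    ... | no i≢j   = δ-≢ (λ e → i≢j (sym (inj e)))

-- Both sides count ordered pairs of elements of b: off the diagonal, d strictly orders them.
sum-pairs : ∀ {n} (d : Fin n → ℕ) → (∀ {v w} → d v ≡ d w → v ≡ w) → (b : Fin n → Bool) →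
  2 * sumF (λ v → 𝟙 (b v) * sumF (λ w → 𝟙 (b w) * 𝟙 ⌊ d w <? d v ⌋)) + sumF (𝟙 ∘ b)
  ≡ sumF (𝟙 ∘ b) * sumF (𝟙 ∘ b)
sum-pairs {n} d inj b = begin
  2 * sumF (λ v → 𝟙 (b v) * sumF (λ w → 𝟙 (b w) * lt w v)) + sumF (𝟙 ∘ b)
    ≡⟨ cong₂ (λ s t → 2 * s + t)
         (sum-cong (λ v → sym (sum-* {n} (𝟙 (b v)) _)))
         (sum-cong (λ v → sym (sum-δ v (𝟙 ∘ b)))) ⟩
  2 * sumF (λ v → sumF (below v)) + sumF (λ v → sumF (diag v))
    ≡⟨ cong (λ s → s + sumF (λ v → sumF (diag v))) (cong (S +_) (+-identityʳ S)) ⟩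
  sumF (λ v → sumF (below v)) + sumF (λ v → sumF (below v)) + sumF (λ v → sumF (diag v))
    ≡⟨ cong (λ s → S + s + sumF (λ v → sumF (diag v))) (sum-swap below) ⟩
  sumF (λ v → sumF (below v)) + sumF (λ v → sumF (λ w → below w v)) + sumF (λ v → sumF (diag v))
    ≡⟨ cong (_+ sumF (λ v → sumF (diag v))) (sym (sum-+ {n} _ _)) ⟩
  sumF (λ v → sumF (below v) + sumF (λ w → below w v)) + sumF (λ v → sumF (diag v))
    ≡⟨ sym (sum-+ {n} _ _) ⟩
  sumF (λ v → sumF (below v) + sumF (λ w → below w v) + sumF (diag v))
    ≡⟨ sum-cong (λ v → trans (cong (_+ sumF (diag v)) (sym (sum-+ {n} _ _))) (sym (sum-+ {n} _ _))) ⟩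
  sumF (λ v → sumF (λ w → below v w + below w v + diag v w))
    ≡⟨ sum-cong (λ v → sum-cong (trichotomy v)) ⟩
  sumF (λ v → sumF (λ w → 𝟙 (b v) * 𝟙 (b w)))
    ≡⟨ sum-×-sum (𝟙 ∘ b) (𝟙 ∘ b) ⟩
  sumF (𝟙 ∘ b) * sumF (𝟙 ∘ b) ∎
  where
  open ≡-Reasoning
  lt : Fin n → Fin n → ℕ
  lt w v = 𝟙 ⌊ d w <? d v ⌋
  below diag : Fin n → Fin n → ℕ
  below v w = 𝟙 (b v) * (𝟙 (b w) * lt w v)
  diag v w = δ v w * 𝟙 (b w)
  S : ℕ
  S = sumF (λ v → sumF (below v))
  factor : ∀ x y l m e → x * (y * l) + y * (x * m) + e * y ≡ x * y * (l + m) + e * y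
  factor = solve-∀
  idem : ∀ p → 𝟙 p * 𝟙 p ≡ 𝟙 p
  idem true  = refl
  idem false = refl
  trichotomy : ∀ v w → below v w + below w v + diag v w ≡ 𝟙 (b v) * 𝟙 (b w)
  trichotomy v w with v F.≟ w
  ... | yes refl rewrite ⌊⌋-false (d v <? d v) (n≮n _) = begin
    𝟙 (b v) * (𝟙 (b v) * 0) + 𝟙 (b v) * (𝟙 (b v) * 0) + 1 * 𝟙 (b v)
      ≡⟨ factor (𝟙 (b v)) (𝟙 (b v)) 0 0 1 ⟩
    𝟙 (b v) * 𝟙 (b v) * 0 + 1 * 𝟙 (b v)
      ≡⟨ cong₂ _+_ (*-zeroʳ (𝟙 (b v) * 𝟙 (b v))) (trans (*-identityˡ _) (sym (idem (b v)))) ⟩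
    𝟙 (b v) * 𝟙 (b v) ∎
  ... | no v≢w = begin
    𝟙 (b v) * (𝟙 (b w) * lt w v) + 𝟙 (b w) * (𝟙 (b v) * lt v w) + 0 * 𝟙 (b w)
      ≡⟨ factor (𝟙 (b v)) (𝟙 (b w)) (lt w v) (lt v w) 0 ⟩
    𝟙 (b v) * 𝟙 (b w) * (lt w v + lt v w) + 0
      ≡⟨ trans (+-identityʳ _) (cong (𝟙 (b v) * 𝟙 (b w) *_) one) ⟩
    𝟙 (b v) * 𝟙 (b w) * 1 ≡⟨ *-identityʳ _ ⟩
    𝟙 (b v) * 𝟙 (b w) ∎
    where
    one : lt w v + lt v w ≡ 1
    one with <-cmp (d v) (d w)
    ... | tri< v<w _ w≮v rewrite ⌊⌋-true (d v <? d w) v<w | ⌊⌋-false (d w <? d v) w≮v = refl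
    ... | tri≈ _ e _ = ⊥-elim (v≢w (inj e))
    ... | tri> v≮w _ w<v rewrite ⌊⌋-false (d v <? d w) v≮w | ⌊⌋-true (d w <? d v) w<v = refl

-- Distances on the directed cycle

module Cycle (N : ℕ) .{{_ : NonZero N}} where

  -- Replaces truncated subtraction and remainder by one linear equation per case, so that later
  -- facts about distances follow by cancellation alone.
  dist-cases : (u v : Fin N) →
    (toℕ u ≤ toℕ v × dist N u v + toℕ u ≡ toℕ v) ⊎
    (toℕ v < toℕ u × dist N u v + toℕ u ≡ toℕ v + N)
  dist-cases u v with toℕ u ≤? toℕ v
  ... | yes u≤v = inj₁ (u≤v , trans (cong (_+ toℕ u) eq) (m∸n+n≡m u≤v))
    where
    eq : dist N u v ≡ toℕ v ∸ toℕ u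
    eq = begin
      (toℕ v + N ∸ toℕ u) % N   ≡⟨ cong (λ m → (m ∸ toℕ u) % N) (+-comm (toℕ v) N) ⟩
      (N + toℕ v ∸ toℕ u) % N   ≡⟨ cong (_% N) (trans (+-∸-assoc N u≤v) (+-comm N _)) ⟩
      (toℕ v ∸ toℕ u + N) % N   ≡⟨ [m+n]%n≡m%n (toℕ v ∸ toℕ u) N ⟩
      (toℕ v ∸ toℕ u) % N       ≡⟨ m<n⇒m%n≡m (≤-<-trans (m∸n≤m (toℕ v) (toℕ u)) (toℕ<n v)) ⟩
      toℕ v ∸ toℕ u             ∎
      where open ≡-Reasoning
  ... | no u≰v = inj₂ (≰⇒> u≰v , trans (cong (_+ toℕ u) (m<n⇒m%n≡m small)) (m∸n+n≡m u≤v+N))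
    where
    u≤v+N : toℕ u ≤ toℕ v + N
    u≤v+N = ≤-trans (<⇒≤ (toℕ<n u)) (m≤n+m N (toℕ v))
    small : toℕ v + N ∸ toℕ u < N
    small = +-cancelʳ-< (toℕ u) _ _ (begin-strict
      toℕ v + N ∸ toℕ u + toℕ u ≡⟨ m∸n+n≡m u≤v+N ⟩
      toℕ v + N                 <⟨ +-monoˡ-< N (≰⇒> u≰v) ⟩
      toℕ u + N                 ≡⟨ +-comm (toℕ u) N ⟩
      N + toℕ u                 ∎)
      where open ≤-Reasoning

  dist-refl : ∀ u → dist N u u ≡ 0
  dist-refl u with dist-cases u u
  ... | inj₁ (_ , e)   = +-cancelʳ-≡ (toℕ u) _ 0 e
  ... | inj₂ (u<u , _) = ⊥-elim (n≮n _ u<u)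

  dist-injective : ∀ u {v w} → dist N u v ≡ dist N u w → v ≡ w
  dist-injective u {v} {w} e with dist-cases u v | dist-cases u w
  ... | inj₁ (_ , p) | inj₁ (_ , q) =
    toℕ-injective (trans (sym p) (trans (cong (_+ toℕ u) e) q))
  ... | inj₂ (_ , p) | inj₂ (_ , q) =
    toℕ-injective (+-cancelʳ-≡ N _ _ (trans (sym p) (trans (cong (_+ toℕ u) e) q)))
  ... | inj₁ (_ , p) | inj₂ (_ , q) =
    ⊥-elim (<⇒≱ (toℕ<n v) (subst (N ≤_) (trans (sym q) (trans (cong (_+ toℕ u) (sym e)) p)) (m≤n+m N (toℕ w))))
  ... | inj₂ (_ , p) | inj₁ (_ , q) =
    ⊥-elim (<⇒≱ (toℕ<n w) (subst (N ≤_) (trans (sym p) (trans (cong (_+ toℕ u) e) q)) (m≤n+m N (toℕ v))))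

  0<dist : ∀ {u v} → u ≢ v → 0 < dist N u v
  0<dist {u} u≢v = n≢0⇒n>0 (λ e → u≢v (dist-injective u (trans (dist-refl u) (sym e))))

  dist-+-dist : ∀ {u v} → u ≢ v → dist N u v + dist N v u ≡ N
  dist-+-dist {u} {v} u≢v with dist-cases u v | dist-cases v u
  ... | inj₁ (u≤v , _) | inj₁ (v≤u , _) = ⊥-elim (u≢v (toℕ-injective (≤-antisym u≤v v≤u)))
  ... | inj₂ (v<u , _) | inj₂ (u<v , _) = ⊥-elim (<-asym u<v v<u)
  ... | inj₁ (_ , p)   | inj₂ (_ , q)   = +-cancelʳ-≡ (toℕ u + toℕ v) _ N
    (trans (+-interchange (dist N u v) _ (toℕ u) _) (trans (cong₂ _+_ p q) (rot (toℕ v) (toℕ u) N)))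
    where
    rot : ∀ a b c → a + (b + c) ≡ c + (b + a)
    rot = solve-∀
  ... | inj₂ (_ , p)   | inj₁ (_ , q)   = +-cancelʳ-≡ (toℕ u + toℕ v) _ N
    (trans (+-interchange (dist N u v) _ (toℕ u) _) (trans (cong₂ _+_ p q) (rot (toℕ v) (toℕ u) N)))
    where
    rot : ∀ a b c → a + c + b ≡ c + (b + a)
    rot = solve-∀

  route : Fin N → Fin N → Fin N → ℕ
  route i u v = 𝟙 (routeUses N u v i)

  -- Walking from u to v, the indicator of having passed the arc (i , i + 1) of the cycle, counted from 0,
  -- changes from [ i < u ] to [ i < v ], plus one if the walk wraps around.
  past : Fin N → Fin N → ℕ
  past i u = 𝟙 ⌊ toℕ i <? toℕ u ⌋

  route-ascending : ∀ {u v} i → toℕ u ≤ toℕ v → route i u v + past i u ≡ past i v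
  route-ascending {u} {v} i u≤v with dist-cases u v | dist-cases u i
  ... | inj₂ (v<u , _) | _ = ⊥-elim (<⇒≱ v<u u≤v)
  ... | inj₁ (_ , p) | inj₁ (u≤i , q) = trans
    (cong₂ _+_ (𝟙-⇔ (λ lt → subst₂ _<_ q p (+-monoˡ-< (toℕ u) lt))
                    (λ lt → +-cancelʳ-< (toℕ u) _ _ (subst₂ _<_ (sym q) (sym p) lt)))
               (𝟙-no (toℕ i <? toℕ u) (≤⇒≯ u≤i)))
    (+-identityʳ _)
  ... | inj₁ (_ , p) | inj₂ (i<u , q) = trans
    (cong₂ _+_ (𝟙-no (dist N u i <? dist N u v) (≤⇒≯ (+-cancelʳ-≤ (toℕ u) _ _
                  (subst₂ _≤_ (sym p) (sym q) (≤-trans (<⇒≤ (toℕ<n v)) (m≤n+m N (toℕ i)))))))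
               (𝟙-yes (toℕ i <? toℕ u) i<u))
    (sym (𝟙-yes (toℕ i <? toℕ v) (<-≤-trans i<u u≤v)))

  route-descending : ∀ {u v} i → toℕ v < toℕ u → route i u v + past i u ≡ past i v + 1
  route-descending {u} {v} i v<u with dist-cases u v | dist-cases u i
  ... | inj₁ (u≤v , _) | _ = ⊥-elim (<⇒≱ v<u u≤v)
  ... | inj₂ (_ , p) | inj₁ (u≤i , q) = trans
    (cong₂ _+_ (𝟙-yes (dist N u i <? dist N u v) (+-cancelʳ-< (toℕ u) _ _
                  (subst₂ _<_ (sym q) (sym p) (<-≤-trans (toℕ<n i) (m≤n+m N (toℕ v))))))
               (𝟙-no (toℕ i <? toℕ u) (≤⇒≯ u≤i)))
    (cong (_+ 1) (sym (𝟙-no (toℕ i <? toℕ v) (≤⇒≯ (≤-trans (<⇒≤ v<u) u≤i)))))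
  ... | inj₂ (_ , p) | inj₂ (i<u , q) =
    cong₂ _+_ (𝟙-⇔ (λ lt → +-cancelʳ-< N _ _ (subst₂ _<_ q p (+-monoˡ-< (toℕ u) lt)))
                   (λ lt → +-cancelʳ-< (toℕ u) _ _ (subst₂ _<_ (sym q) (sym p) (+-monoˡ-< N lt))))
              (𝟙-yes (toℕ i <? toℕ u) i<u)

  -- The walk is closed: adding the three step identities, the `past` terms on both sides are the
  -- same up to order and cancel. What remains is the 1 contributed by the only step that wraps
  -- around, from `c` back to `a`.
  triangle-route : ∀ {a b c} i → toℕ a ≤ toℕ b → toℕ b ≤ toℕ c → toℕ a < toℕ c →
    route i a b + route i b c + route i c a ≡ 1
  triangle-route {a} {b} {c} i a≤b b≤c a<c = +-cancelʳ-≡ (past i a + past i b + past i c) _ 1 (trans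
    (split (route i a b) (route i b c) (route i c a) (past i a) (past i b) (past i c))
    (trans (cong₂ _+_ (cong₂ _+_ (route-ascending i a≤b) (route-ascending i b≤c)) (route-descending i a<c))
           (join (past i a) (past i b) (past i c))))
    where
    split : ∀ r s t x y z → (r + s + t) + (x + y + z) ≡ (r + x) + (s + y) + (t + z)
    split = solve-∀
    join : ∀ x y z → y + z + (x + 1) ≡ 1 + (x + y + z)
    join = solve-∀

  quadrangle-route : ∀ {a b c d} i → toℕ a ≤ toℕ b → toℕ b ≤ toℕ c → toℕ c ≤ toℕ d → toℕ a < toℕ d →
    route i a b + route i b c + route i c d + route i d a ≡ 1
  quadrangle-route {a} {b} {c} {d} i a≤b b≤c c≤d a<d =
    +-cancelʳ-≡ (past i a + past i b + past i c + past i d) _ 1 (trans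
    (split (route i a b) (route i b c) (route i c d) (route i d a)
           (past i a) (past i b) (past i c) (past i d))
    (trans (cong₂ _+_ (cong₂ _+_ (cong₂ _+_ (route-ascending i a≤b) (route-ascending i b≤c))
                                 (route-ascending i c≤d)) (route-descending i a<d))
           (join (past i a) (past i b) (past i c) (past i d))))
    where
    split : ∀ r s t u x y z w → (r + s + t + u) + (x + y + z + w) ≡ (r + x) + (s + y) + (t + z) + (u + w)
    split = solve-∀
    join : ∀ x y z w → y + z + w + (x + 1) ≡ 1 + (x + y + z + w)
    join = solve-∀

-- Lower bound: arcs per vertex in an admissible class.

size : ∀ {n} → Digraph n → ℕ
size B = sumF (λ u → sumF (λ v → 𝟙 (B u v)))

-- Each vertex u of an admissible class has at most one arc to the j-th next vertex of that class,
-- so m arcs out of u cross at least 1 + ⋯ + m of the gaps between consecutive vertices of the class.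
-- Since 1 + ⋯ + k is the capacity of a gap, there are on average at most k arcs per vertex.
module LowerBound (N k C : ℕ) .{{_ : NonZero N}} (2C≤ : 2 * C ≤ k * suc k)
                  (B : Digraph N) (irrefl : ∀ u → B u u ≡ false)
                  (adm : Admissible C N B) where
  open Cycle N

  isVertex : Fin N → Bool
  isVertex x = anyF (λ y → B x y ∨ B y x)

  outdeg : Fin N → ℕ
  outdeg u = sumF (λ v → 𝟙 (B u v))

  -- A gap between consecutive vertices of the class is represented by the cycle arc leaving its
  -- first vertex. This sum is thus the number of gaps crossed on the way from `u` to `v`, with `u`
  -- counted and `v` not.
  hops : Fin N → Fin N → ℕ
  hops u v = sumF (λ i → 𝟙 (isVertex i) * 𝟙 (routeUses N u v i))

  crossed : Fin N → ℕ
  crossed u = sumF (λ v → 𝟙 (B u v) * hops u v)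

  tail-isVertex : ∀ {u v} → B u v ≡ true → isVertex u ≡ true
  tail-isVertex {u} {v} h = anyF-intro _ v (cong (_∨ B v u) h)

  head-isVertex : ∀ {u v} → B u v ≡ true → isVertex v ≡ true
  head-isVertex {u} {v} h = anyF-intro _ u (trans (cong (B v u ∨_) h) (∨-zeroʳ _))

  -- The route leaves `u` and passes every head `w` nearer than `v`; all of these are vertices of
  -- the class. Irreflexivity keeps `u` from being one of the heads, so nothing is counted twice.
  hops≥ : ∀ u v → B u v ≡ true →
          1 + sumF (λ w → 𝟙 (B u w) * 𝟙 ⌊ dist N u w <? dist N u v ⌋) ≤ hops u v
  hops≥ u v h = begin
    1 + sumF (λ w → 𝟙 (B u w) * lt w)             ≡⟨ cong (_+ sumF (λ w → 𝟙 (B u w) * lt w)) (sym (sum-δ₁ u)) ⟩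
    sumF (δ u) + sumF (λ w → 𝟙 (B u w) * lt w)    ≡⟨ sym (sum-+ {N} _ _) ⟩
    sumF (λ w → δ u w + 𝟙 (B u w) * lt w)         ≤⟨ sum-mono {N} pointwise ⟩
    hops u v                                       ∎
    where
    open ≤-Reasoning
    lt : Fin N → ℕ
    lt w = 𝟙 ⌊ dist N u w <? dist N u v ⌋
    u≢v : u ≢ v
    u≢v refl with trans (sym h) (irrefl u)
    ... | ()
    lt-u : lt u ≡ 1
    lt-u = cong 𝟙 (⌊⌋-true (_ <? _) (subst (_< dist N u v) (sym (dist-refl u)) (0<dist u≢v)))
    pointwise : ∀ w → δ u w + 𝟙 (B u w) * lt w ≤ 𝟙 (isVertex w) * lt w
    pointwise w with u F.≟ w
    ... | yes refl = ≤-reflexive (trans (cong (λ b → 1 + 𝟙 b * lt u) (irrefl u))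
                       (sym (cong₂ (λ b l → 𝟙 b * l) (tail-isVertex h) lt-u)))
    ... | no _     = *-monoˡ-≤ (lt w) (𝟙-mono (head-isVertex {u} {w}))

  -- The j-th nearest head costs at least j hops, and m + m * m is 2 (1 + ⋯ + m). Counting pairs of
  -- heads by `sum-pairs` replaces sorting them by distance.
  crossed≥ : ∀ u → outdeg u + outdeg u * outdeg u ≤ 2 * crossed u
  crossed≥ u = begin
    m + m * m
      ≡⟨ cong (m +_) (sym (sum-pairs (dist N u) (dist-injective u) (B u))) ⟩
    m + (2 * sumF (λ v → 𝟙 (B u v) * before v) + m)
      ≡⟨ shuffle m (sumF (λ v → 𝟙 (B u v) * before v)) ⟩
    2 * (m + sumF (λ v → 𝟙 (B u v) * before v))
      ≡⟨ cong (2 *_) (sym (sum-+ {N} _ _)) ⟩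
    2 * sumF (λ v → 𝟙 (B u v) + 𝟙 (B u v) * before v)
      ≤⟨ *-monoʳ-≤ 2 (sum-mono {N} pointwise) ⟩
    2 * crossed u ∎
    where
    open ≤-Reasoning
    m : ℕ
    m = outdeg u
    before : Fin N → ℕ
    before v = sumF (λ w → 𝟙 (B u w) * 𝟙 ⌊ dist N u w <? dist N u v ⌋)
    shuffle : ∀ a s → a + (2 * s + a) ≡ 2 * (a + s)
    shuffle = solve-∀
    scale : ∀ b {x y} → (b ≡ true → 1 + x ≤ y) → 𝟙 b + 𝟙 b * x ≤ 𝟙 b * y
    scale false h = z≤n
    scale true  h = *-monoʳ-≤ 1 (h refl)
    pointwise : ∀ v → 𝟙 (B u v) + 𝟙 (B u v) * before v ≤ 𝟙 (B u v) * hops u v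
    pointwise v = scale (B u v) (hops≥ u v)

  -- Double counting: instead of the gaps met by each arc, count the arcs over each gap. There are
  -- as many gaps as vertices of the class, so the capacity is paid `vertexCount B` times and not
  -- `N` times.
  sum-crossed : sumF crossed ≤ vertexCount B * C
  sum-crossed = begin
    sumF crossed
      ≡⟨ sum-cong {N} (λ u → sum-cong {N} (λ v → trans (sym (sum-* {N} (𝟙 (B u v)) _))
           (sum-cong {N} (λ i → rearrange (B u v) (isVertex i) (routeUses N u v i))))) ⟩
    sumF (λ u → sumF (λ v → sumF (λ i → 𝟙 (isVertex i) * uses u v i)))
      ≡⟨ sum-cong {N} (λ u → sum-swap {N} {N} _) ⟩
    sumF (λ u → sumF (λ i → sumF (λ v → 𝟙 (isVertex i) * uses u v i)))
      ≡⟨ sum-swap {N} {N} _ ⟩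
    sumF (λ i → sumF (λ u → sumF (λ v → 𝟙 (isVertex i) * uses u v i)))
      ≡⟨ sum-cong {N} (λ i → trans (sum-cong {N} (λ u → sum-* {N} (𝟙 (isVertex i)) _)) (sum-* {N} (𝟙 (isVertex i)) _)) ⟩
    sumF (λ i → 𝟙 (isVertex i) * sumF (λ u → sumF (λ v → uses u v i)))
      ≡⟨ sum-cong {N} (λ i → cong (𝟙 (isVertex i) *_) (sum-cong {N} (λ u → sym (countF≡sum {N} _)))) ⟩
    sumF (λ i → 𝟙 (isVertex i) * load N B i)
      ≤⟨ sum-mono {N} (λ i → *-monoʳ-≤ (𝟙 (isVertex i)) (adm i)) ⟩
    sumF (λ i → 𝟙 (isVertex i) * C)
      ≡⟨ trans (sum-cong {N} (λ i → *-comm _ C)) (sum-* {N} C _) ⟩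
    C * sumF (λ i → 𝟙 (isVertex i))
      ≡⟨ trans (*-comm C _) (cong (_* C) (sym (countF≡sum {N} isVertex))) ⟩
    vertexCount B * C ∎
    where
    open ≤-Reasoning
    uses : Fin N → Fin N → Fin N → ℕ
    uses u v i = 𝟙 (B u v ∧ routeUses N u v i)
    rearrange : ∀ a b c → 𝟙 a * (𝟙 b * 𝟙 c) ≡ 𝟙 b * 𝟙 (a ∧ c)
    rearrange true  b c = *-identityˡ _
    rearrange false b c = sym (*-zeroʳ (𝟙 b))

  -- 2 (k + 1) m ≤ m (m + 1) + k (k + 1) says 0 ≤ (m − k) (m − k − 1).
  quadratic : ∀ m → 2 * suc k * m ≤ (m + m * m) + k * suc k
  quadratic m with m ≤? k
  ... | yes m≤k = subst (λ l → 2 * suc l * m ≤ (m + m * m) + l * suc l) (m+[n∸m]≡n m≤k)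
                    (m+n≤o⇒m≤o _ (≤-reflexive (below m (k ∸ m))))
    where
    below : ∀ m j → 2 * (1 + (m + j)) * m + (j * j + j) ≡ (m + m * m) + (m + j) * (1 + (m + j))
    below = solve-∀
  ... | no m≰k = subst (λ l → 2 * suc k * l ≤ (l + l * l) + k * suc k) (m+[n∸m]≡n (≰⇒> m≰k))
                    (m+n≤o⇒m≤o _ (≤-reflexive (above k (m ∸ suc k))))
    where
    above : ∀ k j → 2 * (1 + k) * (1 + k + j) + (j * j + j) ≡
            ((1 + k + j) + (1 + k + j) * (1 + k + j)) + k * (1 + k)
    above = solve-∀

  -- A bound linear in the out-degree can be summed over vertices of different out-degree. The
  -- indicator on the constant term makes it count only vertices of the class; elsewhere the
  -- out-degree is 0.
  outdeg-bound : ∀ u → 2 * suc k * outdeg u ≤ 2 * crossed u + k * suc k * 𝟙 (isVertex u)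
  outdeg-bound u with isVertex u in eq
  ... | true = begin
    2 * suc k * outdeg u                               ≤⟨ quadratic (outdeg u) ⟩
    (outdeg u + outdeg u * outdeg u) + k * suc k       ≤⟨ +-mono-≤ (crossed≥ u) (≤-reflexive (sym (*-identityʳ _))) ⟩
    2 * crossed u + k * suc k * 1                      ∎
    where open ≤-Reasoning
  ... | false = ≤-trans (≤-reflexive (trans (cong (2 * suc k *_) (sum-zero {N} noArc)) (*-zeroʳ (2 * suc k)))) z≤n
    where
    noArc : ∀ v → 𝟙 (B u v) ≡ 0
    noArc v with B u v in h
    ... | false = refl
    ... | true with trans (sym eq) (tail-isVertex h)
    ...   | ()

  size≤k*vertexCount : size B ≤ k * vertexCount B
  size≤k*vertexCount = *-cancelˡ-≤ (2 * suc k) (begin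
    2 * suc k * size B
      ≡⟨ sym (sum-* {N} (2 * suc k) outdeg) ⟩
    sumF (λ u → 2 * suc k * outdeg u)
      ≤⟨ sum-mono {N} outdeg-bound ⟩
    sumF (λ u → 2 * crossed u + k * suc k * 𝟙 (isVertex u))
      ≡⟨ trans (sum-+ {N} _ _) (cong₂ _+_ (sum-* {N} 2 _) (sum-* {N} (k * suc k) _)) ⟩
    2 * sumF crossed + k * suc k * sumF (𝟙 ∘ isVertex)
      ≡⟨ cong (λ p → 2 * sumF crossed + k * suc k * p) (sym (countF≡sum {N} isVertex)) ⟩
    2 * sumF crossed + k * suc k * p
      ≤⟨ +-monoˡ-≤ _ (*-monoʳ-≤ 2 sum-crossed) ⟩
    2 * (p * C) + k * suc k * p
      ≡⟨ cong (_+ k * suc k * p) (swap 2 p C) ⟩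
    -- The capacity hypothesis makes the two terms equal; together they are 2 (k + 1) times k p, and
    -- the factor 2 (k + 1) cancels.
    p * (2 * C) + k * suc k * p
      ≤⟨ +-monoˡ-≤ _ (*-monoʳ-≤ p 2C≤) ⟩
    p * (k * suc k) + k * suc k * p
      ≡⟨ collect p k ⟩
    2 * suc k * (k * p) ∎)
    where
    open ≤-Reasoning
    p : ℕ
    p = vertexCount B
    swap : ∀ a b c → a * (b * c) ≡ b * (a * c)
    swap = solve-∀
    collect : ∀ p k → p * (k * (1 + k)) + k * (1 + k) * p ≡ 2 * (1 + k) * (k * p)
    collect = solve-∀

-- Counting arcs over a tournament and over the classes of a partition.

-- Each of the n * n ordered pairs is exactly one of an arc, a reversed arc or a diagonal pair. The
-- additive form avoids subtraction and halving.
tournament-size : ∀ {n} (T : Digraph n) → (∀ u → T u u ≡ false) →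
                  (∀ u v → u ≢ v → T v u ≡ not (T u v)) → 2 * size T + n ≡ n * n
tournament-size {n} T irrefl tour = begin
  2 * size T + n
    ≡⟨ cong₂ _+_ (cong (size T +_) (+-identityʳ _)) (sym (trans (sum-const n 1) (*-identityʳ n))) ⟩
  size T + size T + sumF {n} (λ _ → 1)
    ≡⟨ cong₂ (λ s t → size T + s + t) (sum-swap {n} {n} _) (sum-cong {n} (λ u → sym (sum-δ₁ {n} u))) ⟩
  size T + sumF (λ u → sumF (λ v → 𝟙 (T v u))) + sumF (λ u → sumF (δ {n} u))
    ≡⟨ trans (cong (_+ sumF (λ u → sumF (δ {n} u))) (sym (sum-+ {n} _ _))) (sym (sum-+ {n} _ _)) ⟩
  sumF (λ u → sumF (λ v → 𝟙 (T u v)) + sumF (λ v → 𝟙 (T v u)) + sumF (δ {n} u))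
    ≡⟨ sum-cong {n} (λ u → trans (cong (_+ sumF (δ {n} u)) (sym (sum-+ {n} _ _))) (sym (sum-+ {n} _ _))) ⟩
  sumF (λ u → sumF (λ v → 𝟙 (T u v) + 𝟙 (T v u) + δ u v))
    ≡⟨ sum-cong {n} (λ u → trans (sum-cong {n} (one u)) (trans (sum-const n 1) (*-identityʳ n))) ⟩
  sumF {n} (λ _ → n)
    ≡⟨ sum-const n n ⟩
  n * n ∎
  where
  open ≡-Reasoning
  complement : ∀ b → 𝟙 b + 𝟙 (not b) ≡ 1
  complement true  = refl
  complement false = refl
  one : ∀ u v → 𝟙 (T u v) + 𝟙 (T v u) + δ u v ≡ 1
  one u v with u F.≟ v
  ... | yes refl rewrite irrefl u = refl
  ... | no u≢v   = trans (+-identityʳ _) (trans (cong (λ b → 𝟙 (T u v) + 𝟙 b) (tour u v u≢v)) (complement (T u v)))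

sum-size-classes : ∀ {n W} (T : Digraph n) (f : Fin n → Fin n → Fin W) →
                   sumF (λ ω → size (classOf T f ω)) ≡ size T
sum-size-classes {n} {W} T f = begin
  sumF (λ ω → size (classOf T f ω))
    ≡⟨ sum-swap {W} {n} _ ⟩
  sumF (λ u → sumF (λ ω → sumF (λ v → 𝟙 (classOf T f ω u v))))
    ≡⟨ sum-cong {n} (λ u → sum-swap {W} {n} _) ⟩
  sumF (λ u → sumF (λ v → sumF (λ ω → 𝟙 (classOf T f ω u v))))
    ≡⟨ sum-cong {n} (λ u → sum-cong {n} (λ v → trans (sum-cong {W} (λ ω → trans (𝟙-∧ (T u v) _) (*-comm (𝟙 (T u v)) _)))
         (sum-δ (f u v) (λ _ → 𝟙 (T u v))))) ⟩
  size T ∎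
  where open ≡-Reasoning

size≤k*cost : ∀ N k C .{{_ : NonZero N}} → 2 * C ≤ k * suc k → (T : Digraph N) → (∀ u → T u u ≡ false) →
              ∀ {W} (f : Fin N → Fin N → Fin W) → ValidPartition C N T W f →
              size T ≤ k * cost T f
size≤k*cost N k C 2C≤ T irrefl {W} f valid = begin
  size T                                        ≡⟨ sym (sum-size-classes T f) ⟩
  sumF (λ ω → size (classOf T f ω))             ≤⟨ sum-mono {W} (λ ω → LowerBound.size≤k*vertexCount N k C 2C≤
                                                     (classOf T f ω) (λ u → cong (_∧ _) (irrefl u)) (valid ω)) ⟩
  sumF (λ ω → k * vertexCount (classOf T f ω))  ≡⟨ sum-* {W} k _ ⟩
  k * cost T f                                  ∎
  where open ≤-Reasoning

-- The vertices of the tournament are ∞ = 0 and two antipodal copies, n apart, of each point of Fin n.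
-- For points x < y, the arcs between their copies form the 4-cycle lower x → lower y → upper x → upper y,
-- and those among ∞, lower x, upper x form the triangle lower x → upper x → ∞; both wind around
-- the ring exactly once.  So any colouring of the pairs of points has, in each colour,
-- a load equal to the number of pairs {x , y}, x = y included, of that colour.

module Doubling (n : ℕ) where

  N : ℕ
  N = suc (n + n)

  open Cycle N

  Vertex : Set
  Vertex = Fin N

  ∞ : Vertex
  ∞ = fzero

  lower upper : Fin n → Vertex
  lower x = fsuc (x ↑ˡ n)
  upper x = fsuc (n ↑ʳ x)

  toℕ-lower : ∀ x → toℕ (lower x) ≡ suc (toℕ x)
  toℕ-lower x = cong suc (toℕ-↑ˡ x n)

  toℕ-upper : ∀ x → toℕ (upper x) ≡ suc (n + toℕ x)
  toℕ-upper x = cong suc (toℕ-↑ʳ n x)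

  -- As N = 2n + 1 is odd, distance at most n is the same as twice the distance being below N, so no
  -- antipodal choice arises. The condition `0 <` excludes loops.
  T : Digraph N
  T u v = ⌊ 0 <? dist N u v ⌋ ∧ ⌊ dist N u v ≤? n ⌋

  T-irrefl : ∀ u → T u u ≡ false
  T-irrefl u = cong (_∧ ⌊ dist N u u ≤? n ⌋) (⌊⌋-false (0 <? dist N u u) (λ lt → n≮0 (subst (0 <_) (dist-refl u) lt)))

  T-≢ : ∀ {u v} → u ≢ v → T u v ≡ ⌊ dist N u v ≤? n ⌋
  T-≢ {u} {v} u≢v = cong (_∧ ⌊ dist N u v ≤? n ⌋) (⌊⌋-true (0 <? dist N u v) (0<dist u≢v))

  T-arc : ∀ u v → u ≢ v → dist N u v ≤ n → T u v ≡ true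
  T-arc u v u≢v d≤n = trans (T-≢ u≢v) (⌊⌋-true (dist N u v ≤? n) d≤n)

  T-requestTournament : IsRequestTournament N T
  T-requestTournament = T-irrefl , tournament , λ u v u≢v short → T-arc u v u≢v (≮⇒≥ (λ n<d →
    <⇒≱ short (subst (N ≤_) (cong (dist N u v +_) (sym (+-identityʳ _))) (+-mono-≤ n<d (<⇒≤ n<d)))))
    where
    tournament : ∀ u v → u ≢ v → T v u ≡ not (T u v)
    tournament u v u≢v rewrite T-≢ u≢v | T-≢ (u≢v ∘ sym) with dist N u v ≤? n
    ... | yes d≤n = ⌊⌋-false (dist N v u ≤? n) (λ d′≤n →
      <⇒≱ (n<1+n (n + n)) (subst (_≤ n + n) (dist-+-dist u≢v) (+-mono-≤ d≤n d′≤n)))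
    ... | no d≰n = ⌊⌋-true (dist N v u ≤? n) (+-cancelˡ-≤ (dist N u v) _ _
      (subst (_≤ dist N u v + n) (sym (dist-+-dist u≢v)) (+-monoˡ-≤ n (≰⇒> d≰n))))

  arc-ascending : ∀ u v → toℕ u < toℕ v → toℕ v ≤ toℕ u + n → T u v ≡ true
  arc-ascending u v u<v v≤u+n with dist-cases u v
  ... | inj₂ (v<u , _) = ⊥-elim (<-asym u<v v<u)
  ... | inj₁ (_ , p)   = T-arc u v (λ { refl → n≮n _ u<v }) (+-cancelʳ-≤ (toℕ u) _ n
    (subst₂ _≤_ (sym p) (+-comm (toℕ u) n) v≤u+n))

  -- A step down by s wraps around and has length 2n + 1 - s, which is at most n exactly when s is
  -- at least n + 1.
  arc-descending : ∀ u v → toℕ v + suc n ≤ toℕ u → T u v ≡ true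
  arc-descending u v far with dist-cases u v
  ... | inj₁ (u≤v , _) = ⊥-elim (<⇒≱ (<-≤-trans (m<m+n (toℕ v) (s≤s z≤n)) far) u≤v)
  ... | inj₂ (v<u , p) = T-arc u v (λ { refl → n≮n _ v<u }) (+-cancelʳ-≤ (toℕ u) _ n
    (subst₂ _≤_ (trans (assoc (toℕ v) n) (sym p)) (+-comm (toℕ u) n) (+-monoˡ-≤ n far)))
    where
    assoc : ∀ a b → a + (1 + b) + b ≡ a + (1 + (b + b))
    assoc = solve-∀

  arcUses : Vertex → Vertex → Vertex → ℕ
  arcUses i u v = 𝟙 (T u v ∧ routeUses N u v i)

  arcUses-arc : ∀ i u v → T u v ≡ true → arcUses i u v ≡ route i u v
  arcUses-arc i u v h = cong (λ b → 𝟙 (b ∧ routeUses N u v i)) h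

  arcUses-reverse : ∀ i u v → T u v ≡ true → arcUses i v u ≡ 0
  arcUses-reverse i u v h = cong (λ b → 𝟙 (b ∧ routeUses N v u i))
    (trans (proj₁ (proj₂ T-requestTournament) u v u≢v) (cong not h))
    where
    u≢v : u ≢ v
    u≢v refl with trans (sym h) (T-irrefl u)
    ... | ()

  arcUses-refl : ∀ i u → arcUses i u u ≡ 0
  arcUses-refl i u = cong (λ b → 𝟙 (b ∧ routeUses N u u i)) (T-irrefl u)

  lower-lower : ∀ {x y} → toℕ x < toℕ y → T (lower x) (lower y) ≡ true
  lower-lower {x} {y} x<y = arc-ascending (lower x) (lower y)
    (subst₂ _<_ (sym (toℕ-lower x)) (sym (toℕ-lower y)) (s≤s x<y))
    (subst₂ _≤_ (sym (toℕ-lower y)) (cong (_+ n) (sym (toℕ-lower x)))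
      (s≤s (≤-trans (<⇒≤ (toℕ<n y)) (m≤n+m n (toℕ x)))))

  upper-upper : ∀ {x y} → toℕ x < toℕ y → T (upper x) (upper y) ≡ true
  upper-upper {x} {y} x<y = arc-ascending (upper x) (upper y)
    (subst₂ _<_ (sym (toℕ-upper x)) (sym (toℕ-upper y)) (s≤s (+-monoʳ-< n x<y)))
    (subst₂ _≤_ (sym (toℕ-upper y)) (cong (_+ n) (sym (toℕ-upper x)))
      (s≤s (≤-trans (+-monoʳ-≤ n (<⇒≤ (toℕ<n y))) (+-monoˡ-≤ n (m≤m+n n (toℕ x))))))

  lower<upper : ∀ x y → toℕ (lower y) < toℕ (upper x)
  lower<upper x y = subst₂ _<_ (sym (toℕ-lower y)) (sym (toℕ-upper x))
    (s≤s (<-≤-trans (toℕ<n y) (m≤m+n n (toℕ x))))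

  -- The length is n + x - y. The weak inequality admits x = y, the arc of maximal length n between
  -- the two copies of one point, which the triangle through ∞ needs.
  lower-upper : ∀ {x y} → toℕ x ≤ toℕ y → T (lower y) (upper x) ≡ true
  lower-upper {x} {y} x≤y = arc-ascending (lower y) (upper x) (lower<upper x y)
    (subst₂ _≤_ (sym (toℕ-upper x)) (cong (_+ n) (sym (toℕ-lower y)))
      (s≤s (subst (_≤ toℕ y + n) (+-comm (toℕ x) n) (+-monoˡ-≤ n x≤y))))

  upper-lower : ∀ {x y} → toℕ x < toℕ y → T (upper y) (lower x) ≡ true
  upper-lower {x} {y} x<y = arc-descending (upper y) (lower x) (subst₂ _≤_ (cong (_+ suc n) (sym (toℕ-lower x))) (sym (toℕ-upper y))
    (s≤s (subst₂ _≤_ (move (toℕ x) n) refl (+-monoʳ-≤ n x<y))))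
    where
    move : ∀ a b → b + (1 + a) ≡ a + (1 + b)
    move = solve-∀

  ∞-lower : ∀ x → T ∞ (lower x) ≡ true
  ∞-lower x = arc-ascending ∞ (lower x) (s≤s z≤n) (subst (_≤ n) (sym (toℕ-lower x)) (toℕ<n x))

  upper-∞ : ∀ x → T (upper x) ∞ ≡ true
  upper-∞ x = arc-descending (upper x) ∞ (subst (suc n ≤_) (sym (toℕ-upper x)) (s≤s (m≤m+n n (toℕ x))))

  among : (Vertex → Vertex → ℕ) → Fin n → Fin n → ℕ
  among F x y = F (lower x) (lower y) + F (lower x) (upper y) + F (upper x) (lower y) + F (upper x) (upper y)

  with-∞ : (Vertex → Vertex → ℕ) → Fin n → ℕ
  with-∞ F x = F ∞ (lower x) + F ∞ (upper x) + F (lower x) ∞ + F (upper x) ∞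

  -- Of the eight ordered pairs of copies, four form the 4-cycle and the other four are their
  -- reverses, which are not arcs and contribute 0.
  among-< : ∀ i {x y} → toℕ x < toℕ y → among (arcUses i) x y + among (arcUses i) y x ≡ 1
  among-< i {x} {y} x<y = trans
    (cong₂ _+_
      (cong₂ _+_ (cong₂ _+_ (cong₂ _+_ (arcUses-arc i (lower x) (lower y) (lower-lower x<y)) (arcUses-reverse i (upper y) (lower x) (upper-lower x<y)))
        (arcUses-reverse i (lower y) (upper x) (lower-upper (<⇒≤ x<y)))) (arcUses-arc i (upper x) (upper y) (upper-upper x<y)))
      (cong₂ _+_ (cong₂ _+_ (cong₂ _+_ (arcUses-reverse i (lower x) (lower y) (lower-lower x<y)) (arcUses-arc i (lower y) (upper x) (lower-upper (<⇒≤ x<y))))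
        (arcUses-arc i (upper y) (lower x) (upper-lower x<y))) (arcUses-reverse i (upper x) (upper y) (upper-upper x<y))))
    (trans (reorder (route i (lower x) (lower y)) (route i (lower y) (upper x))
                    (route i (upper x) (upper y)) (route i (upper y) (lower x)))
           (quadrangle-route i (subst₂ _≤_ (sym (toℕ-lower x)) (sym (toℕ-lower y)) (<⇒≤ (s≤s x<y)))
             (<⇒≤ (lower<upper x y)) (subst₂ _≤_ (sym (toℕ-upper x)) (sym (toℕ-upper y)) (s≤s (+-monoʳ-≤ n (<⇒≤ x<y))))
             (lower<upper y x)))
    where
    reorder : ∀ a b c d → (a + 0 + 0 + c) + (0 + b + d + 0) ≡ a + b + c + d
    reorder = solve-∀

  among-≢ : ∀ i {x y} → x ≢ y → among (arcUses i) x y + among (arcUses i) y x ≡ 1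
  among-≢ i {x} {y} x≢y with <-cmp (toℕ x) (toℕ y)
  ... | tri< x<y _ _ = among-< i x<y
  ... | tri≈ _ x≡y _ = ⊥-elim (x≢y (toℕ-injective x≡y))
  ... | tri> _ _ y<x = trans (+-comm (among (arcUses i) x y) _) (among-< i y<x)

  -- At (x , x), `among` already contains both directions between the two copies, so it is taken
  -- once here, whereas two distinct points need (x , y) and (y , x).
  among-diagonal : ∀ i x → among (arcUses i) x x + with-∞ (arcUses i) x ≡ 1
  among-diagonal i x = trans
    (cong₂ _+_
      (cong₂ _+_ (cong₂ _+_ (cong₂ _+_ (arcUses-refl i (lower x)) (arcUses-arc i (lower x) (upper x) (lower-upper {x} ≤-refl)))
        (arcUses-reverse i (lower x) (upper x) (lower-upper {x} ≤-refl))) (arcUses-refl i (upper x)))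
      (cong₂ _+_ (cong₂ _+_ (cong₂ _+_ (arcUses-arc i ∞ (lower x) (∞-lower x)) (arcUses-reverse i (upper x) ∞ (upper-∞ x)))
        (arcUses-reverse i ∞ (lower x) (∞-lower x))) (arcUses-arc i (upper x) ∞ (upper-∞ x))))
    (trans (reorder (route i ∞ (lower x)) (route i (lower x) (upper x)) (route i (upper x) ∞))
           (triangle-route {∞} {lower x} {upper x} i z≤n (<⇒≤ (lower<upper x x)) (s≤s z≤n)))
    where
    reorder : ∀ a b c → (0 + b + 0 + 0) + (a + 0 + 0 + c) ≡ a + b + c
    reorder = solve-∀

  sum-vertices : (F : Vertex → ℕ) → sumF F ≡ F ∞ + (sumF (F ∘ lower) + sumF (F ∘ upper))
  sum-vertices F = cong (F ∞ +_) (sum-↑ n (F ∘ fsuc))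

  sum-4 : ∀ (f g h l : Fin n → ℕ) → sumF (λ x → f x + g x + h x + l x) ≡ sumF f + sumF g + sumF h + sumF l
  sum-4 f g h l = trans (sum-+ {n} _ l) (cong (_+ sumF l)
    (trans (sum-+ {n} _ h) (cong (_+ sumF h) (sum-+ {n} f g))))

  sum-arcs : (F : Vertex → Vertex → ℕ) →
    sumF (λ u → sumF (F u)) ≡ F ∞ ∞ + (sumF (with-∞ F) + sumF (λ x → sumF (among F x)))
  sum-arcs F = begin
    sumF (λ u → sumF (F u))
      ≡⟨ sum-vertices (λ u → sumF (F u)) ⟩
    sumF (F ∞) + (sumF (λ x → sumF (F (lower x))) + sumF (λ x → sumF (F (upper x))))
      ≡⟨ cong₂ _+_ (sum-vertices (F ∞)) (cong₂ _+_ (row lower) (row upper)) ⟩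
    F ∞ ∞ + (a + b) + ((c + (A + B)) + (d + (C + D)))
      ≡⟨ regroup (F ∞ ∞) a b c d A B C D ⟩
    F ∞ ∞ + ((a + b + c + d) + (A + B + C + D))
      ≡⟨ cong (F ∞ ∞ +_) (cong₂ _+_ (sym (sum-4 _ _ _ _))
           (trans (sym (sum-4 _ _ _ _)) (sum-cong {n} (λ x → sym (sum-4 _ _ _ _))))) ⟩
    F ∞ ∞ + (sumF (with-∞ F) + sumF (λ x → sumF (among F x))) ∎
    where
    open ≡-Reasoning
    block : (Fin n → Vertex) → (Fin n → Vertex) → ℕ
    block α β = sumF (λ x → sumF (λ y → F (α x) (β y)))
    a b c d A B C D : ℕ
    a = sumF (λ x → F ∞ (lower x))
    b = sumF (λ x → F ∞ (upper x))
    c = sumF (λ x → F (lower x) ∞)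
    d = sumF (λ x → F (upper x) ∞)
    A = block lower lower
    B = block lower upper
    C = block upper lower
    D = block upper upper
    row : (α : Fin n → Vertex) →
          sumF (λ x → sumF (F (α x))) ≡ sumF (λ x → F (α x) ∞) + (block α lower + block α upper)
    row α = trans (sum-cong {n} (λ x → sum-vertices (F (α x))))
            (trans (sum-+ {n} _ _) (cong (sumF (λ x → F (α x) ∞) +_) (sum-+ {n} _ _)))
    regroup : ∀ e a b c d A B C D →
      e + (a + b) + ((c + (A + B)) + (d + (C + D))) ≡ e + ((a + b + c + d) + (A + B + C + D))
    regroup = solve-∀

  -- Classes of arcs obtained from a symmetric colouring of pairs of points.

  module Colouring {W : ℕ} (c : Fin n → Fin n → Fin W) (c-sym : ∀ x y → c x y ≡ c y x) (x∞ : Fin n) where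

    point : Vertex → Maybe (Fin n)
    point fzero    = nothing
    point (fsuc u) = just ([ id , id ]′ (splitAt n u))

    point-lower : ∀ x → point (lower x) ≡ just x
    point-lower x = cong (just ∘ [ id , id ]′) (splitAt-↑ˡ n x n)

    point-upper : ∀ x → point (upper x) ≡ just x
    point-upper x = cong (just ∘ [ id , id ]′) (splitAt-↑ʳ n n x)

    -- Arcs between ∞ and a copy of x inherit the colour of (x , x), as does the arc joining the two
    -- copies of x: the triangle of x is monochromatic. The loop at ∞ is no arc but a total function
    -- must colour it; `x∞` gives it the colour of some diagonal pair.
    colour : Maybe (Fin n) → Maybe (Fin n) → Fin W
    colour (just x) (just y) = c x y
    colour (just x) nothing  = c x x
    colour nothing  (just y) = c y y
    colour nothing  nothing  = c x∞ x∞

    f : Vertex → Vertex → Fin W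
    f u v = colour (point u) (point v)

    -- Pairs are ordered and may have x = y, so `pairs ω + diagonal ω` is twice the number of
    -- unordered pairs, repetition allowed, of colour `ω`.
    pairs diagonal : Fin W → ℕ
    pairs ω = sumF (λ x → sumF (λ y → 𝟙 ⌊ c x y F.≟ ω ⌋))
    diagonal ω = sumF (λ x → 𝟙 ⌊ c x x F.≟ ω ⌋)

    module Class (ω : Fin W) (i : Vertex) where

      κ : Fin n → Fin n → ℕ
      κ x y = 𝟙 ⌊ c x y F.≟ ω ⌋

      F : Vertex → Vertex → ℕ
      F u v = 𝟙 (classOf T f ω u v ∧ routeUses N u v i)

      F-colour : ∀ u v {p q} → point u ≡ p → point v ≡ q → F u v ≡ 𝟙 ⌊ colour p q F.≟ ω ⌋ * arcUses i u v
      F-colour u v refl refl = factor (T u v) ⌊ f u v F.≟ ω ⌋ (routeUses N u v i)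
        where
        factor : ∀ a b d → 𝟙 ((a ∧ b) ∧ d) ≡ 𝟙 b * 𝟙 (a ∧ d)
        factor true  b d = 𝟙-∧ b d
        factor false b d = sym (*-zeroʳ (𝟙 b))

      with-∞-F : ∀ x → with-∞ F x ≡ κ x x * with-∞ (arcUses i) x
      with-∞-F x = trans
        (cong₂ _+_ (cong₂ _+_ (cong₂ _+_ (F-colour ∞ (lower x) refl (point-lower x)) (F-colour ∞ (upper x) refl (point-upper x)))
          (F-colour (lower x) ∞ (point-lower x) refl)) (F-colour (upper x) ∞ (point-upper x) refl))
        (factor (κ x x) (arcUses i ∞ (lower x)) (arcUses i ∞ (upper x)) (arcUses i (lower x) ∞) (arcUses i (upper x) ∞))
        where
        factor : ∀ k a b c d → k * a + k * b + k * c + k * d ≡ k * (a + b + c + d)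
        factor = solve-∀

      among-F : ∀ x y → among F x y ≡ κ x y * among (arcUses i) x y
      among-F x y = trans
        (cong₂ _+_ (cong₂ _+_ (cong₂ _+_
          (F-colour (lower x) (lower y) (point-lower x) (point-lower y)) (F-colour (lower x) (upper y) (point-lower x) (point-upper y)))
          (F-colour (upper x) (lower y) (point-upper x) (point-lower y))) (F-colour (upper x) (upper y) (point-upper x) (point-upper y)))
        (factor (κ x y) (arcUses i (lower x) (lower y)) (arcUses i (lower x) (upper y))
                   (arcUses i (upper x) (lower y)) (arcUses i (upper x) (upper y)))
        where
        factor : ∀ k a b c d → k * a + k * b + k * c + k * d ≡ k * (a + b + c + d)
        factor = solve-∀

      F-∞∞ : F ∞ ∞ ≡ 0
      F-∞∞ = trans (F-colour ∞ ∞ refl refl) (trans (cong (κ x∞ x∞ *_) (arcUses-refl i ∞)) (*-zeroʳ (κ x∞ x∞)))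

      load-sum : load N (classOf T f ω) i ≡ sumF (with-∞ F) + sumF (λ x → sumF (among F x))
      load-sum = trans (sum-cong {N} (λ u → countF≡sum {N} (λ v → classOf T f ω u v ∧ routeUses N u v i)))
                 (trans (sum-arcs F) (cong (_+ (sumF (with-∞ F) + sumF (λ x → sumF (among F x)))) F-∞∞))

      -- The doubled load spread over ordered pairs: (x , y) and (y , x) each carry the full 4-cycle
      -- of the two points, and (x , x) carries its triangle twice. Each closed walk contributes 1
      -- if it has colour `ω`.
      cell : ∀ x y → δ x y * (2 * with-∞ F y) + (among F x y + among F y x) ≡ κ x y + δ x y * κ y y
      cell x y = trans
        (cong₂ (λ s t → δ x y * (2 * s) + t) (with-∞-F y) (cong₂ _+_ (among-F x y)
          (trans (among-F y x) (cong (λ ω′ → 𝟙 ⌊ ω′ F.≟ ω ⌋ * among (arcUses i) y x) (c-sym y x)))))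
        (weigh (x F.≟ y))
        where
        collect : ∀ k s t → 1 * (2 * (k * s)) + (k * t + k * t) ≡ k * (t + s) + k * (t + s)
        collect = solve-∀
        twice : ∀ k → k * 1 + k * 1 ≡ k + 1 * k
        twice = solve-∀
        once : ∀ k → k * 1 ≡ k + 0
        once = solve-∀
        A : Fin n → Fin n → ℕ
        A = among (arcUses i)
        weigh : Dec (x ≡ y) → δ x y * (2 * (κ y y * with-∞ (arcUses i) y)) + (κ x y * A x y + κ x y * A y x)
                ≡ κ x y + δ x y * κ y y
        weigh (yes refl) = subst
          (λ e → e * (2 * (κ x x * with-∞ (arcUses i) x)) + (κ x x * A x x + κ x x * A x x) ≡ κ x x + e * κ x x)
          (sym (δ-refl x))
          (trans (collect (κ x x) (with-∞ (arcUses i) x) (A x x))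
          (trans (cong (λ s → κ x x * s + κ x x * s) (among-diagonal i x)) (twice (κ x x))))
        weigh (no x≢y) = subst
          (λ e → e * (2 * (κ y y * with-∞ (arcUses i) y)) + (κ x y * A x y + κ x y * A y x) ≡ κ x y + e * κ y y)
          (sym (δ-≢ x≢y))
          (trans (sym (*-distribˡ-+ (κ x y) _ _)) (trans (cong (κ x y *_) (among-≢ i x≢y)) (once (κ x y))))

      2*load : 2 * load N (classOf T f ω) i ≡ pairs ω + diagonal ω
      2*load = begin
        2 * load N (classOf T f ω) i
          ≡⟨ cong (2 *_) load-sum ⟩
        2 * (sumF (with-∞ F) + P)
          ≡⟨ double (sumF (with-∞ F)) P ⟩
        2 * sumF (with-∞ F) + (P + P)
          ≡⟨ cong₂ _+_ (sym (sum-* {n} 2 _)) (cong (P +_) (sum-swap {n} {n} _)) ⟩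
        sumF (λ x → 2 * with-∞ F x) + (P + sumF (λ x → sumF (λ y → among F y x)))
          ≡⟨ cong₂ _+_ (sum-cong {n} (λ x → sym (sum-δ x (λ y → 2 * with-∞ F y)))) (sum-sum-+ _ _) ⟩
        sumF (λ x → sumF (λ y → δ x y * (2 * with-∞ F y))) + sumF (λ x → sumF (λ y → among F x y + among F y x))
          ≡⟨ sum-sum-+ _ _ ⟩
        sumF (λ x → sumF (λ y → δ x y * (2 * with-∞ F y) + (among F x y + among F y x)))
          ≡⟨ sum-cong {n} (λ x → sum-cong {n} (cell x)) ⟩
        sumF (λ x → sumF (λ y → κ x y + δ x y * κ y y))
          ≡⟨ sym (sum-sum-+ _ _) ⟩
        pairs ω + sumF (λ x → sumF (λ y → δ x y * κ y y))
          ≡⟨ cong (pairs ω +_) (sum-cong {n} (λ x → sum-δ x (λ y → κ y y))) ⟩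
        pairs ω + diagonal ω ∎
        where
        open ≡-Reasoning
        P : ℕ
        P = sumF (λ x → sumF (among F x))
        double : ∀ a b → 2 * (a + b) ≡ 2 * a + (b + b)
        double = solve-∀
        sum-sum-+ : (g h : Fin n → Fin n → ℕ) →
          sumF (λ x → sumF (g x)) + sumF (λ x → sumF (h x)) ≡ sumF (λ x → sumF (λ y → g x y + h x y))
        sum-sum-+ g h = trans (sym (sum-+ {n} _ _)) (sum-cong {n} (λ x → sym (sum-+ {n} (g x) (h x))))

    sum-pairs-colours : sumF pairs ≡ n * n
    sum-pairs-colours = begin
      sumF pairs
        ≡⟨ sum-swap {W} {n} _ ⟩
      sumF (λ x → sumF (λ ω → sumF (λ y → 𝟙 ⌊ c x y F.≟ ω ⌋)))
        ≡⟨ sum-cong {n} (λ x → sum-swap {W} {n} _) ⟩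
      sumF (λ x → sumF (λ y → sumF (δ (c x y))))
        ≡⟨ sum-cong {n} (λ x → trans (sum-cong {n} (λ y → sum-δ₁ (c x y))) (trans (sum-const n 1) (*-identityʳ n))) ⟩
      sumF {n} (λ _ → n)
        ≡⟨ sum-const n n ⟩
      n * n ∎
      where open ≡-Reasoning

    -- A covered point accounts for its two copies, and ∞ is met only through diagonal pairs.
    -- `covers` speaks of the first point of a pair; symmetry of the colouring carries it over to
    -- the second.
    vertexCount-class : ∀ ω (p : Fin n → Bool) (p∞ : Bool) →
      (∀ x y → c x y ≡ ω → p x ≡ true) → (∀ x → c x x ≡ ω → p∞ ≡ true) →
      vertexCount (classOf T f ω) ≤ 𝟙 p∞ + (sumF (𝟙 ∘ p) + sumF (𝟙 ∘ p))
    vertexCount-class ω p p∞ covers covers-∞ = begin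
      vertexCount (classOf T f ω)
        ≡⟨ countF≡sum {N} (λ u → anyF (λ v → classOf T f ω u v ∨ classOf T f ω v u)) ⟩
      sumF (λ u → 𝟙 (anyF (λ v → classOf T f ω u v ∨ classOf T f ω v u)))
        ≤⟨ sum-mono {N} (λ u → 𝟙-mono (incident u)) ⟩
      sumF (λ u → 𝟙 (covered (point u)))
        ≡⟨ sum-vertices (λ u → 𝟙 (covered (point u))) ⟩
      𝟙 p∞ + (sumF (λ x → 𝟙 (covered (point (lower x)))) + sumF (λ x → 𝟙 (covered (point (upper x)))))
        ≡⟨ cong (𝟙 p∞ +_) (cong₂ _+_ (sum-cong {n} (λ x → cong (𝟙 ∘ covered) (point-lower x)))
                                     (sum-cong {n} (λ x → cong (𝟙 ∘ covered) (point-upper x)))) ⟩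
      𝟙 p∞ + (sumF (𝟙 ∘ p) + sumF (𝟙 ∘ p)) ∎
      where
      open ≤-Reasoning
      covered : Maybe (Fin n) → Bool
      covered = maybe′ p p∞
      source : ∀ r s → colour r s ≡ ω → covered r ≡ true
      source (just x) (just y) = covers x y
      source (just x) nothing  = covers x x
      source nothing  (just y) = covers-∞ y
      source nothing  nothing  = covers-∞ x∞
      colour-sym : ∀ r s → colour r s ≡ colour s r
      colour-sym (just x) (just y) = c-sym x y
      colour-sym (just x) nothing  = refl
      colour-sym nothing  (just y) = refl
      colour-sym nothing  nothing  = refl
      coloured : ∀ u v → classOf T f ω u v ≡ true → f u v ≡ ω
      coloured u v h = ⌊⌋-sound (f u v F.≟ ω) (proj₂ (∧-elim {T u v} h))
      incident : ∀ u → anyF (λ v → classOf T f ω u v ∨ classOf T f ω v u) ≡ true → covered (point u) ≡ true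
      incident u h with anyF-elim _ h
      ... | v , either with ∨-elim {classOf T f ω u v} either
      ...   | inj₁ out = source (point u) (point v) (coloured u v out)
      ...   | inj₂ inn = source (point u) (point v) (trans (colour-sym (point u) (point v)) (coloured v u inn))

-- The colouring given by the blocks and groups of the design.

module FromGDD (k q : ℕ) .{{_ : NonZero k}} (1≤q : 1 ≤ q) (gdd : GDDType k q) where

  nb n : ℕ
  nb = proj₁ gdd
  n = q * k

  B : Fin nb → Fin (suc k) → GVertex k q
  B = proj₁ (proj₂ gdd)

  transversal : ∀ t i j → i ≢ j → proj₁ (B t i) ≢ proj₁ (B t j)
  transversal = proj₁ (proj₂ (proj₂ gdd))

  cover : ∀ x y → proj₁ x ≢ proj₁ y → Σ (Fin nb) λ t → (x ∈B B t × y ∈B B t) ×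
          (∀ t′ → x ∈B B t′ → y ∈B B t′ → t′ ≡ t)
  cover = proj₂ (proj₂ (proj₂ gdd))

  coords : Fin n → GVertex k q
  coords = remQuot {q} k

  coords-injective : ∀ {x y} → coords x ≡ coords y → x ≡ y
  coords-injective {x} {y} e = trans (sym (combine-remQuot {q} k x))
    (trans (cong (uncurry combine) e) (combine-remQuot {q} k y))

  group : Fin n → Fin q
  group = proj₁ ∘ coords

  -- Block colours come first, group colours after them. A pair (x , x) falls under its group, which
  -- sends the triangle of x to the group class.
  c : Fin n → Fin n → Fin (nb + q)
  c x y with group x F.≟ group y
  ... | yes _ = nb ↑ʳ group x
  ... | no x≁y = proj₁ (cover (coords x) (coords y) x≁y) ↑ˡ q

  block≢group : ∀ {t : Fin nb} {j : Fin q} → t ↑ˡ q ≢ nb ↑ʳ j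
  block≢group {t} {j} e with trans (sym (splitAt-↑ˡ nb t q)) (trans (cong (splitAt nb) e) (splitAt-↑ʳ nb q j))
  ... | ()

  block-injective : ∀ {t t′ : Fin nb} → t ↑ˡ q ≡ t′ ↑ˡ q → t ≡ t′
  block-injective = ↑ˡ-injective q _ _

  c-within : ∀ x y → group x ≡ group y → c x y ≡ nb ↑ʳ group x
  c-within x y x~y with group x F.≟ group y
  ... | yes _  = refl
  ... | no x≁y = ⊥-elim (x≁y x~y)

  c-across : ∀ x y → group x ≢ group y → Σ (Fin nb) λ t → c x y ≡ t ↑ˡ q ×
             (coords x ∈B B t × coords y ∈B B t) × (∀ t′ → coords x ∈B B t′ → coords y ∈B B t′ → t′ ≡ t)
  c-across x y x≁y with group x F.≟ group y
  ... | yes x~y = ⊥-elim (x≁y x~y)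
  ... | no x≁y′ = let t , both , unique = cover (coords x) (coords y) x≁y′ in t , refl , both , unique

  -- The design may pick its witness for (x , y) and for (y , x) independently; uniqueness of the
  -- block through two points identifies them.
  c-sym : ∀ x y → c x y ≡ c y x
  c-sym x y with group x F.≟ group y
  ... | yes x~y = trans (cong (nb ↑ʳ_) x~y) (sym (c-within y x (sym x~y)))
  ... | no x≁y with cover (coords x) (coords y) x≁y | c-across y x (x≁y ∘ sym)
  ...   | t , _ , unique | t′ , e , (y∈ , x∈) , _ = trans (cong (_↑ˡ q) (sym (unique t′ x∈ y∈))) (sym e)

  c-group : ∀ x y j → c x y ≡ nb ↑ʳ j → group x ≡ j × group y ≡ j
  c-group x y j e with group x F.≟ group y
  ... | yes x~y = gx , trans (sym x~y) gx
    where
    gx : group x ≡ j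
    gx = ↑ʳ-injective nb _ _ e
  ... | no _ = ⊥-elim (block≢group e)

  c-block : ∀ x y t → c x y ≡ t ↑ˡ q → x ≢ y × coords x ∈B B t × coords y ∈B B t
  c-block x y t e with group x F.≟ group y
  ... | yes _  = ⊥-elim (block≢group (sym e))
  ... | no x≁y with cover (coords x) (coords y) x≁y
  ...   | t′ , both , _ = (λ { refl → x≁y refl }) , subst (λ s → coords x ∈B B s × coords y ∈B B s) (block-injective e) both

  -- Blocks are transversal, so distinct points of a block lie in different groups and are coloured
  -- by a block; by uniqueness it is `t`.
  c-block⁻¹ : ∀ x y t → x ≢ y → coords x ∈B B t → coords y ∈B B t → c x y ≡ t ↑ˡ q
  c-block⁻¹ x y t x≢y (i , Bi≡x) (j , Bj≡y) with c-across x y (subst₂ _≢_ (cong proj₁ Bi≡x) (cong proj₁ Bj≡y)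
    (transversal t i j (λ { refl → x≢y (coords-injective (trans (sym Bi≡x) Bj≡y)) })))
  ... | t′ , e , _ , unique = trans e (cong (_↑ˡ q) (sym (unique t (i , Bi≡x) (j , Bj≡y))))

  blockPoint : Fin nb → Fin (suc k) → Fin n
  blockPoint t i = uncurry combine (B t i)

  coords-blockPoint : ∀ t i → coords (blockPoint t i) ≡ B t i
  coords-blockPoint t i = remQuot-combine (proj₁ (B t i)) (proj₂ (B t i))

  blockPoint-injective : ∀ t {i j} → blockPoint t i ≡ blockPoint t j → i ≡ j
  blockPoint-injective t {i} {j} e with i F.≟ j
  ... | yes i≡j = i≡j
  ... | no i≢j  = ⊥-elim (transversal t i j i≢j (cong proj₁
    (trans (sym (coords-blockPoint t i)) (trans (cong coords e) (coords-blockPoint t j)))))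

  inBlock? : ∀ t x → Dec (∃ λ i → blockPoint t i ≡ x)
  inBlock? t x = any? (λ i → blockPoint t i F.≟ x)

  inBlock⇒∈B : ∀ {t x} → (∃ λ i → blockPoint t i ≡ x) → coords x ∈B B t
  inBlock⇒∈B {t} (i , e) = i , trans (sym (coords-blockPoint t i)) (cong coords e)

  ∈B⇒inBlock : ∀ {t x} → coords x ∈B B t → ∃ λ i → blockPoint t i ≡ x
  ∈B⇒inBlock {t} (i , e) = i , coords-injective (trans (coords-blockPoint t i) e)

  inBlock : Fin nb → Fin n → Bool
  inBlock t x = ⌊ inBlock? t x ⌋

  inGroup : Fin q → Fin n → Bool
  inGroup j x = ⌊ j F.≟ group x ⌋

  sum-inBlock : ∀ t → sumF (𝟙 ∘ inBlock t) ≡ suc k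
  sum-inBlock t = sum-image (blockPoint t) (blockPoint-injective t)

  sum-inGroup : ∀ j → sumF (𝟙 ∘ inGroup j) ≡ k
  sum-inGroup j = begin
    sumF (𝟙 ∘ inGroup j)
      ≡⟨ sum-combine q {k} (𝟙 ∘ inGroup j) ⟩
    sumF (λ i → sumF (λ a → δ j (group (combine {q} i a))))
      ≡⟨ sum-cong {q} (λ i → sum-cong {k} (λ a → trans (cong (δ j ∘ proj₁) (remQuot-combine i a)) (sym (*-identityʳ (δ j i))))) ⟩
    sumF (λ i → sumF {k} (λ _ → δ j i * 1))
      ≡⟨ sum-cong {q} (λ i → sum-* {k} (δ j i) (λ _ → 1)) ⟩
    sumF (λ i → δ j i * sumF {k} (λ _ → 1))
      ≡⟨ sum-δ j (λ _ → sumF {k} (λ _ → 1)) ⟩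
    sumF {k} (λ _ → 1)
      ≡⟨ trans (sum-const k 1) (*-identityʳ k) ⟩
    k ∎
    where open ≡-Reasoning

  x∞ : Fin n
  x∞ = fromℕ< {0} (*-mono-≤ 1≤q (n≢0⇒n>0 (≢-nonZero⁻¹ k)))

  open Doubling n
  open Colouring c c-sym x∞

  -- Only pairs of distinct points have a block colour; adding the k + 1 diagonal pairs of the block
  -- completes the square of its point set.
  sum-inBlock² : ∀ t → pairs (t ↑ˡ q) + suc k ≡ suc k * suc k
  sum-inBlock² t = begin
    pairs (t ↑ˡ q) + suc k
      ≡⟨ cong (pairs (t ↑ˡ q) +_) (sym (trans (sum-cong {n} (λ x → sum-δ x (𝟙 ∘ inBlock t))) (sum-inBlock t))) ⟩
    pairs (t ↑ˡ q) + sumF (λ x → sumF (λ y → δ x y * 𝟙 (inBlock t y)))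
      ≡⟨ trans (sym (sum-+ {n} _ _)) (sum-cong {n} (λ x → sym (sum-+ {n} _ _))) ⟩
    sumF (λ x → sumF (λ y → 𝟙 ⌊ c x y F.≟ t ↑ˡ q ⌋ + δ x y * 𝟙 (inBlock t y)))
      ≡⟨ sum-cong {n} (λ x → sum-cong {n} (cell x)) ⟩
    sumF (λ x → sumF (λ y → 𝟙 (inBlock t x) * 𝟙 (inBlock t y)))
      ≡⟨ sum-×-sum {n} {n} _ _ ⟩
    sumF (𝟙 ∘ inBlock t) * sumF (𝟙 ∘ inBlock t)
      ≡⟨ cong₂ _*_ (sum-inBlock t) (sum-inBlock t) ⟩
    suc k * suc k ∎
    where
    open ≡-Reasoning
    cell : ∀ x y → 𝟙 ⌊ c x y F.≟ t ↑ˡ q ⌋ + δ x y * 𝟙 (inBlock t y) ≡ 𝟙 (inBlock t x) * 𝟙 (inBlock t y)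
    cell x y with x F.≟ y
    ... | yes refl = trans
      (cong (_+ 1 * 𝟙 (inBlock t x)) (𝟙-no (c x x F.≟ t ↑ˡ q) (λ e → proj₁ (c-block x x t e) refl)))
      (idem (inBlock t x))
      where
      idem : ∀ b → 1 * 𝟙 b ≡ 𝟙 b * 𝟙 b
      idem true  = refl
      idem false = refl
    ... | no x≢y with inBlock? t x | inBlock? t y
    ...   | yes x∈ | yes y∈ = cong (_+ 0) (𝟙-yes (c x y F.≟ t ↑ˡ q) (c-block⁻¹ x y t x≢y (inBlock⇒∈B x∈) (inBlock⇒∈B y∈)))
    ...   | yes _  | no y∉  = cong (_+ 0) (𝟙-no (c x y F.≟ t ↑ˡ q) (λ e → y∉ (∈B⇒inBlock (proj₂ (proj₂ (c-block x y t e))))))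
    ...   | no x∉  | _      = cong (_+ 0) (𝟙-no (c x y F.≟ t ↑ˡ q) (λ e → x∉ (∈B⇒inBlock (proj₁ (proj₂ (c-block x y t e))))))

  pairs-block : ∀ t → pairs (t ↑ˡ q) ≡ k * suc k
  pairs-block t = +-cancelʳ-≡ (suc k) _ _ (trans (sum-inBlock² t) (+-comm (suc k) (k * suc k)))

  diagonal-block : ∀ t → diagonal (t ↑ˡ q) ≡ 0
  diagonal-block t = sum-zero {n} (λ x → 𝟙-no (c x x F.≟ t ↑ˡ q) (λ e → proj₁ (c-block x x t e) refl))

  pairs-group : ∀ j → pairs (nb ↑ʳ j) ≡ k * k
  pairs-group j = begin
    pairs (nb ↑ʳ j)
      ≡⟨ sum-cong {n} (λ x → sum-cong {n} (cell x)) ⟩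
    sumF (λ x → sumF (λ y → 𝟙 (inGroup j x) * 𝟙 (inGroup j y)))
      ≡⟨ sum-×-sum {n} {n} _ _ ⟩
    sumF (𝟙 ∘ inGroup j) * sumF (𝟙 ∘ inGroup j)
      ≡⟨ cong₂ _*_ (sum-inGroup j) (sum-inGroup j) ⟩
    k * k ∎
    where
    open ≡-Reasoning
    cell : ∀ x y → 𝟙 ⌊ c x y F.≟ nb ↑ʳ j ⌋ ≡ 𝟙 (inGroup j x) * 𝟙 (inGroup j y)
    cell x y with j F.≟ group x | j F.≟ group y
    ... | yes j~x | yes j~y = 𝟙-yes (c x y F.≟ nb ↑ʳ j)
      (trans (c-within x y (trans (sym j~x) j~y)) (cong (nb ↑ʳ_) (sym j~x)))
    ... | yes _   | no j≁y  = 𝟙-no (c x y F.≟ nb ↑ʳ j) (λ e → j≁y (sym (proj₂ (c-group x y j e))))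
    ... | no j≁x  | _       = 𝟙-no (c x y F.≟ nb ↑ʳ j) (λ e → j≁x (sym (proj₁ (c-group x y j e))))

  diagonal-group : ∀ j → diagonal (nb ↑ʳ j) ≡ k
  diagonal-group j = trans (sum-cong {n} cell) (sum-inGroup j)
    where
    cell : ∀ x → 𝟙 ⌊ c x x F.≟ nb ↑ʳ j ⌋ ≡ 𝟙 (inGroup j x)
    cell x = 𝟙-⇔ {d = c x x F.≟ nb ↑ʳ j} {j F.≟ group x} (λ e → sym (proj₁ (c-group x x j e)))
                 (λ e → trans (c-within x x refl) (cong (nb ↑ʳ_) (sym e)))

  data Colour : Fin (nb + q) → Set where
    block : ∀ t → Colour (t ↑ˡ q)
    ofGroup : ∀ j → Colour (nb ↑ʳ j)

  classify : ∀ ω → Colour ω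
  classify ω with splitAt nb ω in eq
  ... | inj₁ t = subst Colour (splitAt⁻¹-↑ˡ eq) (block t)
  ... | inj₂ j = subst Colour (splitAt⁻¹-↑ʳ eq) (ofGroup j)

  -- The balance behind the construction: (k + 1) k + 0 for a block and k k + k for a group. The
  -- triangles through ∞ make up for the point that a group has fewer than a block.
  pairs+diagonal : ∀ ω → pairs ω + diagonal ω ≡ k * suc k
  pairs+diagonal ω with classify ω
  ... | block t   = trans (cong₂ _+_ (pairs-block t) (diagonal-block t)) (+-identityʳ _)
  ... | ofGroup j = trans (cong₂ _+_ (pairs-group j) (diagonal-group j))
                          (trans (+-comm (k * k) k) (sym (*-suc k k)))

  valid : ValidPartition ((k * suc k) / 2) N T (nb + q) f
  -- The load equals the capacity; halving the identity for the doubled load also shows that the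
  -- integer division is exact.
  valid ω i = begin
    l               ≡⟨ sym (m*n/n≡m l 2) ⟩
    (l * 2) / 2     ≡⟨ cong (_/ 2) (trans (*-comm l 2) (trans (Class.2*load ω i) (pairs+diagonal ω))) ⟩
    (k * suc k) / 2 ∎
    where
    open ≤-Reasoning
    l : ℕ
    l = load N (classOf T f ω) i

  class-vertices : Fin (nb + q) → ℕ
  class-vertices ω = vertexCount (classOf T f ω)

  class-vertices-block : ∀ t → class-vertices (t ↑ˡ q) ≤ suc k + suc k
  class-vertices-block t = subst (λ s → class-vertices (t ↑ˡ q) ≤ s + s) (sum-inBlock t)
    (vertexCount-class (t ↑ˡ q) (inBlock t) false
      (λ x y e → ⌊⌋-true (inBlock? t x) (∈B⇒inBlock (proj₁ (proj₂ (c-block x y t e)))))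
      (λ x e → ⊥-elim (proj₁ (c-block x x t e) refl)))

  class-vertices-group : ∀ j → class-vertices (nb ↑ʳ j) ≤ 1 + (k + k)
  class-vertices-group j = subst (λ s → class-vertices (nb ↑ʳ j) ≤ 1 + (s + s)) (sum-inGroup j)
    (vertexCount-class (nb ↑ʳ j) (inGroup j) true
      (λ x y e → ⌊⌋-true (j F.≟ group x) (sym (proj₁ (c-group x y j e))))
      (λ x e → refl))

  -- Every ordered pair of points has one colour. This equation determines the number of blocks.
  pairs-count : nb * (k * suc k) + q * (k * k) ≡ n * n
  pairs-count = begin
    nb * (k * suc k) + q * (k * k)
      ≡⟨ sym (cong₂ _+_ (trans (sum-cong {nb} pairs-block) (sum-const nb (k * suc k)))
                        (trans (sum-cong {q} pairs-group) (sum-const q (k * k)))) ⟩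
    sumF (λ t → pairs (t ↑ˡ q)) + sumF (λ j → pairs (nb ↑ʳ j))
      ≡⟨ sym (sum-↑ nb pairs) ⟩
    sumF pairs
      ≡⟨ sum-pairs-colours ⟩
    n * n ∎
    where open ≡-Reasoning

  -- Multiplying by k turns vertex estimates into arc counts: 2 k (k + 1) for a block and 2 k k + k
  -- for a group. These are twice the pairs, plus k per group, so `pairs-count` applies.
  cost≤ : cost T f ≤ N * q
  cost≤ = *-cancelˡ-≤ k (begin
    k * cost T f
      ≡⟨ cong (k *_) (sum-↑ nb class-vertices) ⟩
    k * (sumF (λ t → class-vertices (t ↑ˡ q)) + sumF (λ j → class-vertices (nb ↑ʳ j)))
      ≤⟨ *-monoʳ-≤ k (+-mono-≤ (sum-mono {nb} class-vertices-block) (sum-mono {q} class-vertices-group)) ⟩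
    k * (sumF {nb} (λ _ → suc k + suc k) + sumF {q} (λ _ → 1 + (k + k)))
      ≡⟨ cong (k *_) (cong₂ _+_ (sum-const nb _) (sum-const q _)) ⟩
    k * (nb * (suc k + suc k) + q * (1 + (k + k)))
      ≡⟨ toPairs k nb q ⟩
    2 * (nb * (k * suc k) + q * (k * k)) + q * k
      ≡⟨ cong (λ s → 2 * s + q * k) pairs-count ⟩
    2 * (q * k * (q * k)) + q * k
      ≡⟨ toN k q ⟩
    k * (N * q) ∎)
    where
    open ≤-Reasoning
    toPairs : ∀ k b q → k * (b * ((1 + k) + (1 + k)) + q * (1 + (k + k))) ≡
              2 * (b * (k * (1 + k)) + q * (k * k)) + q * k
    toPairs = solve-∀
    toN : ∀ k q → 2 * (q * k * (q * k)) + q * k ≡ k * ((1 + (q * k + q * k)) * q)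
    toN = solve-∀

-- Optimality, and the value in the form N (N - 1) / 2k.

cost≥ : ∀ k q .{{_ : NonZero k}} → let N = suc (q * k + q * k) in
  (T : Digraph N) → IsRequestTournament N T → ∀ {W} (f : Fin N → Fin N → Fin W) →
  ValidPartition ((k * suc k) / 2) N T W f → N * q ≤ cost T f
cost≥ k q T (irrefl , tournament , _) f valid = *-cancelˡ-≤ k (begin
  k * (N * q)   ≡⟨ sym size-T ⟩
  size T        ≤⟨ size≤k*cost N k ((k * suc k) / 2)
                     (subst (_≤ k * suc k) (*-comm ((k * suc k) / 2) 2) (m/n*n≤m (k * suc k) 2)) T irrefl f valid ⟩
  k * cost T f  ∎)
  where
  open ≤-Reasoning
  N : ℕ
  N = suc (q * k + q * k)
  expand : ∀ k q → (1 + (q * k + q * k)) * (1 + (q * k + q * k)) ≡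
           2 * (k * ((1 + (q * k + q * k)) * q)) + (1 + (q * k + q * k))
  expand = solve-∀
  -- Since N - 1 = 2 q k, the arc count N (N - 1) / 2 is k N q.
  size-T : size T ≡ k * (N * q)
  size-T = *-cancelˡ-≡ _ _ 2 (+-cancelʳ-≡ N _ _ (trans (tournament-size T irrefl tournament) (expand k q)))

theorem5 : (k q : ℕ) .{{_ : NonZero k}} → 1 ≤ q → GDDType k q →
    IsA ((k * suc k) / 2) (suc (2 * k * q))
    (_/_ (suc (2 * k * q) * (suc (2 * k * q) ∸ 1)) (2 * k) {{m*n≢0 2 k}})
-- The doubling lives on `suc (q * k + q * k)` vertices; transporting only below `suc` keeps the
-- `NonZero` instance in place.
theorem5 k q 1≤q gdd = subst₂ (λ M m → IsA ((k * suc k) / 2) (suc M) m) (ring k q) (sym value)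
  ( (D.T , D.T-requestTournament , _ , Col.f , G.valid ,
     -- The lower bound applied to the construction itself turns the estimate of its cost into an
     -- equality.
     ≤-antisym G.cost≤ (cost≥ k q D.T D.T-requestTournament Col.f G.valid))
  , λ T rt W f valid → cost≥ k q T rt f valid)
  where
  module G = FromGDD k q 1≤q gdd
  module D = Doubling (q * k)
  module Col = D.Colouring G.c G.c-sym G.x∞
  ring : ∀ k q → q * k + q * k ≡ 2 * k * q
  ring = solve-∀
  value : _/_ (suc (2 * k * q) * (2 * k * q)) (2 * k) {{m*n≢0 2 k}} ≡ suc (q * k + q * k) * q
  value = trans (cong (λ m → _/_ m (2 * k) {{m*n≢0 2 k}}) (regroup (suc (2 * k * q)) (2 * k) q))
    (trans (m*n/n≡m (suc (2 * k * q) * q) (2 * k) {{m*n≢0 2 k}})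
           (cong (λ M → suc M * q) (sym (ring k q))))
    where
    regroup : ∀ a b c → a * (b * c) ≡ a * c * b
    regroup = solve-∀
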